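{- Let $t \geq 2$ and $1 \leq k_1 \leq \cdots \leq k_t$ be integers with $n = k_1 + \cdots + k_t \geq 4$, and let $X$ be a graph on $n$ vertices. Then: \begin{enumerate} \item If $t = 2$ and $k_1 \geq 2$, then $\mathsf{FS}(X, K_{k_1, n-k_1})$ is disconnected if $X$ is disconnected, is bipartite, is a cycle, or contains a $k_1$-bridge. \item If $t > 2$ and either $k_t > 2$ or $\gcd(k_1,\ldots,k_t) > 1$, then $\mathsf{FS}(X, K_{k_1,\ldots,k_t})$ is disconnected if $X$ is disconnected, is a cycle, or contains an $(n-k_t)$-bridge. \item If $t > 2$, $k_1 = 1$, and $k_t = 2$, then $\mathsf{FS}(X, K_{k_1,\ldots,k_t})$ is disconnected if $X$ is disconnected or is a path. \end{enumerate}
   Context: All graphs are simple. For graphs $X, Y$ on $n$ vertices, the friends-and-strangers graph $\mathsf{FS}(X,Y)$ has as vertices all bijections $\sigma: V(X) \to V(Y)$; two bijections $\sigma, \sigma'$ are adjacent iff there is an edge $\{a,b\} \in E(X)$ with $\{\sigma(a),\sigma(b)\} \in E(Y)$, $\sigma'(a) = \sigma(b)$, $\sigma'(b) = \sigma(a)$, and $\sigma'(c) = \sigma(c)$ for all other $c$. $K_{k_1,\ldots,k_t}$ denotes the complete $t$-partite graph with partition classes of sizes $k_1,\ldots,k_t$. A path $v_1, \ldots, v_k$ in a graph is a $k$-bridge if each edge of the path is a cut-edge, $v_2,\ldots,v_{k-1}$ have degree $2$, and $v_1, v_k$ do not have degree $1$; a single cut-vertex is a $1$-bridge. -}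

module Defs where

open import Data.Nat using (ℕ; zero; suc; _+_; _∸_; _<_; _≤_)
open import Data.Nat.GCD using (gcd)
open import Data.Bool using (Bool; true; false; if_then_else_)
open import Data.Fin using (Fin; toℕ; splitAt)
import Data.Fin as F
open import Data.Vec using (Vec; []; _∷_; tabulate)
import Data.Vec as V
import Data.Empty
open import Data.Sum using (_⊎_; inj₁; inj₂)
open import Data.Product using (Σ; _×_; _,_; ∃; ∃-syntax)
open import Data.Fin.Permutation using (Permutation′; _⟨$⟩ʳ_)
open import Relation.Binary.PropositionalEquality using (_≡_; _≢_)
open import Relation.Nullary using (¬_)
open import Function.Bundles using (_⇔_)

record Graph (n : ℕ) : Set where
  field
    adj    : Fin n → Fin n → Bool
    sym    : ∀ u v → adj u v ≡ adj v u
    irrefl : ∀ v → adj v v ≡ false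
open Graph public

Edge : ∀ {n} → Graph n → Fin n → Fin n → Set
Edge X u v = adj X u v ≡ true

data Walk {n : ℕ} (R : Fin n → Fin n → Set) : Fin n → Fin n → Set where
  here : ∀ {u} → Walk R u u
  step : ∀ {u v w} → R u v → Walk R v w → Walk R u w

Connected : ∀ {n} → Graph n → Set
Connected X = ∀ u v → Walk (Edge X) u v

Disconnected : ∀ {n} → Graph n → Set
Disconnected X = ¬ Connected X

Bipartite : ∀ {n} → Graph n → Set
Bipartite {n} X = Σ (Fin n → Bool) λ f → ∀ u v → Edge X u v → f u ≢ f v

PathAdj : ∀ {n} → Fin n → Fin n → Set
PathAdj i j = (suc (toℕ i) ≡ toℕ j) ⊎ (suc (toℕ j) ≡ toℕ i)

CycleAdj : ∀ {n} → Fin n → Fin n → Set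
CycleAdj {n} i j = PathAdj i j ⊎ ((toℕ i ≡ 0 × suc (toℕ j) ≡ n) ⊎ (toℕ j ≡ 0 × suc (toℕ i) ≡ n))

IsCycle : ∀ {n} → Graph n → Set
IsCycle {n} X = Σ (Permutation′ n) λ π → ∀ u v → Edge X u v ⇔ CycleAdj (π ⟨$⟩ʳ u) (π ⟨$⟩ʳ v)

IsPath : ∀ {n} → Graph n → Set
IsPath {n} X = Σ (Permutation′ n) λ π → ∀ u v → Edge X u v ⇔ PathAdj (π ⟨$⟩ʳ u) (π ⟨$⟩ʳ v)

degree : ∀ {n} → Graph n → Fin n → ℕ
degree X v = V.sum (tabulate (λ u → if adj X v u then 1 else 0))

EdgeMinus : ∀ {n} → Graph n → Fin n → Fin n → Fin n → Fin n → Set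
EdgeMinus X u v a b = Edge X a b × ¬ ((a ≡ u × b ≡ v) ⊎ (a ≡ v × b ≡ u))

CutEdge : ∀ {n} → Graph n → Fin n → Fin n → Set
CutEdge X u v = Edge X u v × ¬ Walk (EdgeMinus X u v) u v

VertexMinus : ∀ {n} → Graph n → Fin n → Fin n → Fin n → Set
VertexMinus X w a b = Edge X a b × a ≢ w × b ≢ w

CutVertex : ∀ {n} → Graph n → Fin n → Set
CutVertex {n} X w = Σ (Fin n) λ a → Σ (Fin n) λ b →
  a ≢ w × b ≢ w × Walk (Edge X) a b × ¬ Walk (VertexMinus X w) a b

HasBridge : ∀ {n} → Graph n → ℕ → Set
HasBridge {n} X k =
  (k ≡ 1 × Σ (Fin n) (CutVertex X)) ⊎
  (2 ≤ k × Σ (ℕ → Fin n) λ v →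
     (∀ i j → i < k → j < k → v i ≡ v j → i ≡ j) ×
     (∀ i → suc i < k → CutEdge X (v i) (v (suc i))) ×
     (∀ i → 0 < i → suc i < k → degree X (v i) ≡ 2) ×
     degree X (v 0) ≢ 1 × degree X (v (k ∸ 1)) ≢ 1)

classOf : ∀ {t} (ks : Vec ℕ t) → Fin (V.sum ks) → Fin t
classOf (k ∷ ks) x with splitAt k x
... | inj₁ _ = F.zero
... | inj₂ y = F.suc (classOf ks y)


open import Relation.Nullary.Decidable using (⌊_⌋)
open import Data.Bool using (not)
open import Relation.Binary.PropositionalEquality using (refl; cong)
open import Relation.Nullary using (yes; no)
import Relation.Binary.PropositionalEquality as Eq

private
  diff : ∀ {t} → Fin t → Fin t → Bool
  diff i j = not ⌊ i F.≟ j ⌋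

  diff-sym : ∀ {t} (i j : Fin t) → diff i j ≡ diff j i
  diff-sym i j with i F.≟ j | j F.≟ i
  ... | yes _ | yes _ = refl
  ... | no _  | no _  = refl
  ... | yes p | no q  = Data.Empty.⊥-elim (q (Eq.sym p))
  ... | no p  | yes q = Data.Empty.⊥-elim (p (Eq.sym q))

  diff-irr : ∀ {t} (i : Fin t) → diff i i ≡ false
  diff-irr i with i F.≟ i
  ... | yes _ = refl
  ... | no p  = Data.Empty.⊥-elim (p refl)

K : ∀ {t} (ks : Vec ℕ t) → Graph (V.sum ks)
K ks = record
  { adj    = λ u v → diff (classOf ks u) (classOf ks v)
  ; sym    = λ u v → diff-sym (classOf ks u) (classOf ks v)
  ; irrefl = λ v → diff-irr (classOf ks v)
  }

firstV : ∀ {t} → Vec ℕ t → ℕ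
firstV []      = 0
firstV (k ∷ _) = k

lastV : ∀ {t} → Vec ℕ t → ℕ
lastV []           = 0
lastV (k ∷ [])     = k
lastV (_ ∷ k ∷ ks) = lastV (k ∷ ks)

gcdV : ∀ {t} → Vec ℕ t → ℕ
gcdV = V.foldr _ gcd 0

-- Friends-and-strangers graph FS(X,Y): vertices are bijections
-- σ : V(X) → V(Y), i.e. permutations of Fin n.

FSAdj : ∀ {n} → Graph n → Graph n → Permutation′ n → Permutation′ n → Set
FSAdj {n} X Y σ σ′ = Σ (Fin n) λ a → Σ (Fin n) λ b →
  Edge X a b × Edge Y (σ ⟨$⟩ʳ a) (σ ⟨$⟩ʳ b) ×
  σ′ ⟨$⟩ʳ a ≡ σ ⟨$⟩ʳ b × σ′ ⟨$⟩ʳ b ≡ σ ⟨$⟩ʳ a ×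
  (∀ c → c ≢ a → c ≢ b → σ′ ⟨$⟩ʳ c ≡ σ ⟨$⟩ʳ c)

-- paths in FS(X,Y); bijections are compared extensionally (pointwise)
data FSWalk {n : ℕ} (X Y : Graph n) : Permutation′ n → Permutation′ n → Set where
  here : ∀ {σ τ} → (∀ x → σ ⟨$⟩ʳ x ≡ τ ⟨$⟩ʳ x) → FSWalk X Y σ τ
  step : ∀ {σ ρ τ} → FSAdj X Y σ ρ → FSWalk X Y ρ τ → FSWalk X Y σ τ

FSConnected : ∀ {n} → Graph n → Graph n → Set
FSConnected {n} X Y = (σ τ : Permutation′ n) → FSWalk X Y σ τ

FSDisconnected : ∀ {n} → Graph n → Graph n → Set
FSDisconnected X Y = ¬ FSConnected X Y

-- View a vertex σ of FS(X, Y) through the position σ⁻¹(p) of each p ∈ V(Y). In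
-- every case some function of the positions is unchanged by all moves but not
-- constant.
--   * X disconnected: the connected component of the position of each p.
--   * X and Y bipartite: the sign of σ plus, modulo 2, the number of vertices of
--     one class of Y lying in one class of X.
--   * X a path or a cycle: the parity of the number of inversions among selected
--     pairs of nonadjacent vertices of Y. A move along the path never inverts such
--     a pair. The move of a and b across the closing edge of the cycle inverts
--     exactly the selected pairs containing a or b, an even number if all vertices
--     lie in equally many selected pairs modulo 2. Select the three pairs of a
--     triple in a class of size at least 3, or all the classes when they have
--     size 2.
--   * X with an (n − k_t)-bridge: which vertices of the class of size k_t stand on
--     the left, that is, would fill the part of X before the bridge if that class
--     were pushed towards it in order; the class is too large for two of them to
--     change their order across the bridge.
module Submission where

open import Defs hiding (sym; irrefl)
open import Data.Nat using (ℕ; zero; suc; _+_; _∸_; _≤_; _<_; _<ᵇ_; _<?_; z≤n; s≤s; z<s)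
open import Data.Nat.Divisibility using (_∣_; ∣-trans; ∣1⇒≡1)
open import Data.Nat.GCD using (gcd[m,n]∣m; gcd[m,n]∣n)
open import Data.Nat.Properties as ℕₚ using (<-cmp; ≤-antisym; ≤∧≢⇒<; ≤⇒≯; m<n⇒m<1+n; n<1+n)
import Data.Bool as Bool
open import Data.Bool using (Bool; true; false; not; _∧_; _∨_; _xor_; if_then_else_)
open import Data.Bool.Properties using (xor-∧-commutativeRing; xor-same; xor-comm; xor-assoc; xor-identityʳ; ∧-distribˡ-xor; ∧-zeroʳ; ∧-identityʳ; ∧-comm; ∨-comm; ¬-not)
open import Data.Fin using (Fin; toℕ)
import Data.Fin as F
open import Data.Fin.Properties as Finₚ using (toℕ-injective; toℕ<n; any?; toℕ-fromℕ<; fromℕ<-injective; ↑ˡ-injective; ↑ʳ-injective; splitAt-↑ˡ; splitAt-↑ʳ; ≤fromℕ)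
open import Data.Fin.Permutation as Perm using (Permutation′; _⟨$⟩ʳ_; _⟨$⟩ˡ_; inverseˡ; inverseʳ)
open import Data.Vec using (Vec; []; _∷_; lookup; sum; tabulate)
open import Data.Product using (_×_; _,_; Σ; proj₁; proj₂)
open import Data.Sum using (_⊎_; inj₁; inj₂)
open import Algebra.Bundles using (CommutativeRing; CommutativeMonoid)
import Algebra.Properties.CommutativeMonoid.Sum as CommutativeMonoidSum
import Algebra.Properties.CommutativeSemigroup as CommutativeSemigroupProperties
open import Effect.Monad using (RawMonad)
open import Function using (_∘_)
open import Function.Bundles using (module Equivalence)
open import Relation.Nullary using (¬_; Dec; yes; no; does; contradiction)
open import Relation.Nullary.Decidable using (dec-true; dec-false; ¬?; _×-dec_; ¬¬-excluded-middle)
open import Relation.Nullary.Negation using (¬¬-Monad)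
open import Relation.Binary.Definitions using (tri<; tri≈; tri>)
open import Relation.Binary.PropositionalEquality using (_≡_; _≢_; refl; sym; trans; cong; cong₂; subst; subst₂; module ≡-Reasoning)

-- Addition modulo 2 and the two points of a swap

xor-commutativeMonoid : CommutativeMonoid _ _
xor-commutativeMonoid = CommutativeRing.+-commutativeMonoid xor-∧-commutativeRing

module ⊕ = CommutativeMonoidSum xor-commutativeMonoid

open CommutativeSemigroupProperties (CommutativeMonoid.commutativeSemigroup xor-commutativeMonoid)
  using () renaming (interchange to xor-interchange)

⨁ : ∀ {n} → (Fin n → Bool) → Bool
⨁ = ⊕.sum

data Position {n} (a b : Fin n) : Fin n → Set where
  at-a : Position a b a
  at-b : Position a b b
  off  : ∀ {i} → i ≢ a → i ≢ b → Position a b i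

position : ∀ {n} (a b i : Fin n) → Position a b i
position a b i with i F.≟ a | i F.≟ b
... | yes refl | _        = at-a
... | no _     | yes refl = at-b
... | no i≢a   | no i≢b   = off i≢a i≢b

xor-cancelˡ : ∀ x y → x xor (x xor y) ≡ y
xor-cancelˡ x y = trans (sym (xor-assoc x x y)) (cong (_xor y) (xor-same x))

xor≡false⇒≡ : ∀ {x y} → x xor y ≡ false → x ≡ y
xor≡false⇒≡ {true}  {true}  _ = refl
xor≡false⇒≡ {false} {false} _ = refl

-- Sums modulo 2

⨁-zero : ∀ {n} {f : Fin n → Bool} → (∀ i → f i ≡ false) → ⨁ f ≡ false
⨁-zero {zero}  f≡0 = refl
⨁-zero {suc n} f≡0 = cong₂ _xor_ (f≡0 F.zero) (⨁-zero (f≡0 ∘ F.suc))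

⨁-single : ∀ {n} (f : Fin n → Bool) a → (∀ i → i ≢ a → f i ≡ false) → ⨁ f ≡ f a
⨁-single f F.zero    f≡0 =
  trans (cong (f F.zero xor_) (⨁-zero λ i → f≡0 (F.suc i) λ ())) (xor-identityʳ _)
⨁-single f (F.suc a) f≡0 =
  cong₂ _xor_ (f≡0 F.zero λ ()) (⨁-single (f ∘ F.suc) a λ i i≢a → f≡0 (F.suc i) λ { refl → i≢a refl })

⨁-remove : ∀ {n} (f : Fin n → Bool) a → ⨁ f ≡ f a xor ⨁ (λ i → not (does (i F.≟ a)) ∧ f i)
⨁-remove f a = begin
  ⨁ f                                                    ≡⟨ ⊕.sum-cong-≗ split ⟩
  ⨁ (λ i → on i xor (not (does (i F.≟ a)) ∧ f i))        ≡⟨ ⊕.∑-distrib-+ on _ ⟩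
  ⨁ on xor ⨁ (λ i → not (does (i F.≟ a)) ∧ f i)          ≡⟨ cong (_xor ⨁ (λ i → not (does (i F.≟ a)) ∧ f i)) (⨁-single on a on-off) ⟩
  on a xor ⨁ (λ i → not (does (i F.≟ a)) ∧ f i)          ≡⟨ cong (λ e → (e ∧ f a) xor ⨁ (λ i → not (does (i F.≟ a)) ∧ f i)) (dec-true (a F.≟ a) refl) ⟩
  f a xor ⨁ (λ i → not (does (i F.≟ a)) ∧ f i)           ∎
  where
  open ≡-Reasoning
  on : _ → Bool
  on i = does (i F.≟ a) ∧ f i
  split : ∀ i → f i ≡ on i xor (not (does (i F.≟ a)) ∧ f i)
  split i with does (i F.≟ a)
  ... | true  = sym (xor-identityʳ _)
  ... | false = refl
  on-off : ∀ i → i ≢ a → on i ≡ false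
  on-off i i≢a = cong (_∧ f i) (dec-false (i F.≟ a) i≢a)

⨁-pair : ∀ {n} (f : Fin n → Bool) {a b} → a ≢ b → (∀ i → i ≢ a → i ≢ b → f i ≡ false) → ⨁ f ≡ f a xor f b
⨁-pair f {a} {b} a≢b f≡0 = trans (⨁-remove f a) (cong (f a xor_) rest)
  where
  off-b : ∀ i → i ≢ b → not (does (i F.≟ a)) ∧ f i ≡ false
  off-b i i≢b with i F.≟ a
  ... | yes _   = refl
  ... | no  i≢a = f≡0 i i≢a i≢b
  rest : ⨁ (λ i → not (does (i F.≟ a)) ∧ f i) ≡ f b
  rest = trans (⨁-single _ b off-b) (cong (λ e → not e ∧ f b) (dec-false (b F.≟ a) (a≢b ∘ sym)))

-- Only entries strictly above the diagonal are added, so each unordered pair counts once.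
⨁⨁ : ∀ {n} → (Fin n → Fin n → Bool) → Bool
⨁⨁ {zero}  g = false
⨁⨁ {suc n} g = ⨁ (λ j → g F.zero (F.suc j)) xor ⨁⨁ (λ i j → g (F.suc i) (F.suc j))

⨁⨁-cong : ∀ {n} {g h : Fin n → Fin n → Bool} → (∀ i j → g i j ≡ h i j) → ⨁⨁ g ≡ ⨁⨁ h
⨁⨁-cong {zero}  g≡h = refl
⨁⨁-cong {suc n} g≡h = cong₂ _xor_ (⊕.sum-cong-≗ λ j → g≡h F.zero (F.suc j)) (⨁⨁-cong λ i j → g≡h (F.suc i) (F.suc j))

⨁⨁-zero : ∀ {n} {g : Fin n → Fin n → Bool} → (∀ i j → g i j ≡ false) → ⨁⨁ g ≡ false
⨁⨁-zero {zero}  g≡0 = refl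
⨁⨁-zero {suc n} g≡0 = cong₂ _xor_ (⨁-zero λ j → g≡0 F.zero (F.suc j)) (⨁⨁-zero λ i j → g≡0 (F.suc i) (F.suc j))

⨁⨁-xor : ∀ {n} (g h : Fin n → Fin n → Bool) → ⨁⨁ (λ i j → g i j xor h i j) ≡ ⨁⨁ g xor ⨁⨁ h
⨁⨁-xor {zero}  g h = refl
⨁⨁-xor {suc n} g h = trans
  (cong₂ _xor_ (⊕.∑-distrib-+ (λ j → g F.zero (F.suc j)) (λ j → h F.zero (F.suc j)))
               (⨁⨁-xor (λ i j → g (F.suc i) (F.suc j)) (λ i j → h (F.suc i) (F.suc j))))
  (xor-interchange (⨁ (λ j → g F.zero (F.suc j))) (⨁ (λ j → h F.zero (F.suc j)))
     (⨁⨁ (λ i j → g (F.suc i) (F.suc j))) (⨁⨁ (λ i j → h (F.suc i) (F.suc j))))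

-- Each pair containing `a` occurs once, with `a` as its first or second member; symmetry moves all
-- of them into row `a`, whose diagonal entry adds nothing.
⨁⨁-star : ∀ {n} (g : Fin n → Fin n → Bool) a → (∀ i j → g i j ≡ g j i) → g a a ≡ false →
          (∀ i j → i ≢ a → j ≢ a → g i j ≡ false) → ⨁⨁ g ≡ ⨁ (g a)
⨁⨁-star g F.zero    g-sym gaa g≡0 = begin
  ⨁ (λ j → g F.zero (F.suc j)) xor ⨁⨁ (λ i j → g (F.suc i) (F.suc j)) ≡⟨ cong (⨁ (λ j → g F.zero (F.suc j)) xor_) (⨁⨁-zero λ i j → g≡0 (F.suc i) (F.suc j) (λ ()) (λ ())) ⟩
  ⨁ (λ j → g F.zero (F.suc j)) xor false                              ≡⟨ xor-identityʳ _ ⟩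
  ⨁ (λ j → g F.zero (F.suc j))                                        ≡⟨ cong (_xor ⨁ (λ j → g F.zero (F.suc j))) gaa ⟨
  g F.zero F.zero xor ⨁ (λ j → g F.zero (F.suc j))                    ∎
  where open ≡-Reasoning
⨁⨁-star g (F.suc a) g-sym gaa g≡0 = cong₂ _xor_
  (trans (⨁-single _ a λ j j≢a → g≡0 F.zero (F.suc j) (λ ()) λ { refl → j≢a refl }) (g-sym F.zero (F.suc a)))
  (⨁⨁-star (λ i j → g (F.suc i) (F.suc j)) a (λ i j → g-sym _ _) gaa
    λ i j i≢a j≢a → g≡0 _ _ (λ { refl → i≢a refl }) (λ { refl → j≢a refl }))

-- The pairs touching `a` form a star at `a`, the others a star at `b`. The two full rows both count
-- the pair of `a` and `b`; the last term corrects this.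
⨁⨁-double-star : ∀ {n} (g : Fin n → Fin n → Bool) {a b} → a ≢ b → (∀ i j → g i j ≡ g j i) →
                 g a a ≡ false → g b b ≡ false →
                 (∀ i j → i ≢ a → i ≢ b → j ≢ a → j ≢ b → g i j ≡ false) →
                 ⨁⨁ g ≡ (⨁ (g a) xor ⨁ (g b)) xor g a b
⨁⨁-double-star g {a} {b} a≢b g-sym gaa gbb g≡0 = begin
  ⨁⨁ g                                    ≡⟨ ⨁⨁-cong (λ i j → split (touches i j) (g i j)) ⟩
  ⨁⨁ (λ i j → g₁ i j xor g₂ i j)          ≡⟨ ⨁⨁-xor g₁ g₂ ⟩
  ⨁⨁ g₁ xor ⨁⨁ g₂                         ≡⟨ cong₂ _xor_ (⨁⨁-star g₁ a g₁-sym g₁aa g₁≡0) (⨁⨁-star g₂ b g₂-sym g₂bb g₂≡0) ⟩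
  ⨁ (g₁ a) xor ⨁ (g₂ b)                   ≡⟨ cong₂ _xor_ (⊕.sum-cong-≗ g₁a) g₂b ⟩
  ⨁ (g a) xor (⨁ (g b) xor g a b)         ≡⟨ xor-assoc (⨁ (g a)) _ _ ⟨
  (⨁ (g a) xor ⨁ (g b)) xor g a b         ∎
  where
  open ≡-Reasoning
  touches : _ → _ → Bool
  touches i j = does (i F.≟ a) ∨ does (j F.≟ a)
  touches-sym : ∀ i j → touches i j ≡ touches j i
  touches-sym i j = ∨-comm (does (i F.≟ a)) _
  g₁ g₂ : _ → _ → Bool
  g₁ i j = touches i j ∧ g i j
  g₂ i j = not (touches i j) ∧ g i j
  split : ∀ t x → x ≡ (t ∧ x) xor (not t ∧ x)
  split true  x = sym (xor-identityʳ x)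
  split false x = refl
  g₁-sym : ∀ i j → g₁ i j ≡ g₁ j i
  g₁-sym i j = cong₂ _∧_ (touches-sym i j) (g-sym i j)
  g₂-sym : ∀ i j → g₂ i j ≡ g₂ j i
  g₂-sym i j = cong₂ _∧_ (cong not (touches-sym i j)) (g-sym i j)
  g₁aa : g₁ a a ≡ false
  g₁aa = trans (cong (touches a a ∧_) gaa) (∧-zeroʳ _)
  g₂bb : g₂ b b ≡ false
  g₂bb = trans (cong (not (touches b b) ∧_) gbb) (∧-zeroʳ _)
  g₁≡0 : ∀ i j → i ≢ a → j ≢ a → g₁ i j ≡ false
  g₁≡0 i j i≢a j≢a rewrite dec-false (i F.≟ a) i≢a | dec-false (j F.≟ a) j≢a = refl
  g₂≡0 : ∀ i j → i ≢ b → j ≢ b → g₂ i j ≡ false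
  g₂≡0 i j i≢b j≢b with i F.≟ a | j F.≟ a
  ... | yes _   | _       = refl
  ... | no _    | yes _   = refl
  ... | no i≢a  | no j≢a  = g≡0 i j i≢a i≢b j≢a j≢b
  g₁a : ∀ j → g₁ a j ≡ g a j
  g₁a j rewrite dec-true (a F.≟ a) refl = refl
  g₂b : ⨁ (g₂ b) ≡ ⨁ (g b) xor g a b
  g₂b = begin
    ⨁ (g₂ b)                                              ≡⟨ ⊕.sum-cong-≗ (λ j → cong (λ e → not (e ∨ does (j F.≟ a)) ∧ g b j) (dec-false (b F.≟ a) (a≢b ∘ sym))) ⟩
    ⨁ (λ j → not (does (j F.≟ a)) ∧ g b j)                ≡⟨ xor-cancelˡ (g b a) _ ⟨
    g b a xor (g b a xor ⨁ (λ j → not (does (j F.≟ a)) ∧ g b j)) ≡⟨ cong (g b a xor_) (⨁-remove (g b) a) ⟨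
    g b a xor ⨁ (g b)                                     ≡⟨ xor-comm (g b a) _ ⟩
    ⨁ (g b) xor g b a                                     ≡⟨ cong (⨁ (g b) xor_) (g-sym b a) ⟩
    ⨁ (g b) xor g a b                                     ∎

-- Weighted inversion parity

-- Pairs in increasing order are counted. For injective `h` this differs from the parity of the
-- weighted inversions only by the total weight, which does not depend on `h`.
inversions : ∀ {n} → (Fin n → Fin n → Bool) → (Fin n → ℕ) → Bool
inversions w h = ⨁⨁ (λ i j → w i j ∧ (h i <ᵇ h j))

inversions-cong : ∀ {n} (w : Fin n → Fin n → Bool) {h h′ : Fin n → ℕ} → (∀ i → h i ≡ h′ i) →
                  inversions w h ≡ inversions w h′
inversions-cong w h≡h′ = ⨁⨁-cong λ i j → cong (w i j ∧_) (cong₂ _<ᵇ_ (h≡h′ i) (h≡h′ j))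

record Swapped {n} {A : Set} (h h′ : Fin n → A) (a b : Fin n) : Set where
  field
    to-b : h′ a ≡ h b
    to-a : h′ b ≡ h a
    rest : ∀ {c} → c ≢ a → c ≢ b → h′ c ≡ h c

swapped-sym : ∀ {n} {A : Set} {h h′ : Fin n → A} {a b} → Swapped h h′ a b → Swapped h h′ b a
swapped-sym s = record { to-b = to-a ; to-a = to-b ; rest = λ c≢b c≢a → rest c≢a c≢b }
  where open Swapped s

swapped-reverse : ∀ {n} {A : Set} {h h′ : Fin n → A} {a b} → Swapped h h′ a b → Swapped h′ h a b
swapped-reverse s = record { to-b = sym to-a ; to-a = sym to-b ; rest = λ c≢a c≢b → sym (rest c≢a c≢b) }
  where open Swapped s

swapped-map : ∀ {n} {A B : Set} (g : A → B) {h h′ : Fin n → A} {a b} → Swapped h h′ a b → Swapped (g ∘ h) (g ∘ h′) a b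
swapped-map g s = record { to-b = cong g to-b ; to-a = cong g to-a ; rest = λ c≢a c≢b → cong g (rest c≢a c≢b) }
  where open Swapped s

<ᵇ-true : ∀ {x y} → x < y → (x <ᵇ y) ≡ true
<ᵇ-true {x} {y} = dec-true (x <? y)

<ᵇ-false : ∀ {x y} → ¬ x < y → (x <ᵇ y) ≡ false
<ᵇ-false {x} {y} = dec-false (x <? y)

<ᵇ-antisym : ∀ {x y} → x ≢ y → (x <ᵇ y) xor (y <ᵇ x) ≡ true
<ᵇ-antisym {x} {y} x≢y with <-cmp x y
... | tri< x<y _ y≮x rewrite <ᵇ-true x<y | <ᵇ-false y≮x = refl
... | tri≈ _ x≡y _ = contradiction x≡y x≢y
... | tri> x≮y _ y<x rewrite <ᵇ-true y<x | <ᵇ-false x≮y = refl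

module _ {n} (w : Fin n → Fin n → Bool) (w-sym : ∀ i j → w i j ≡ w j i)
         {h h′ : Fin n → ℕ} {a b : Fin n}
         (h-inj : ∀ {i j} → h i ≡ h j → i ≡ j)
         (a≢b : a ≢ b) (swap : Swapped h h′ a b) where

  open Swapped swap

  private
    -- The weighted pairs whose order is reversed by the swap.
    d : Fin n → Fin n → Bool
    d i j = w i j ∧ ((h i <ᵇ h j) xor (h′ i <ᵇ h′ j))

    h′-inj : ∀ {i j} → h′ i ≡ h′ j → i ≡ j
    h′-inj {i} {j} eq with position a b i | position a b j
    ... | at-a | at-a = refl
    ... | at-b | at-b = refl
    ... | at-a | at-b = sym (h-inj (trans (sym to-b) (trans eq to-a)))
    ... | at-b | at-a = sym (h-inj (trans (sym to-a) (trans eq to-b)))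
    ... | at-a | off p q = contradiction (h-inj (trans (sym (rest p q)) (trans (sym eq) to-b))) q
    ... | at-b | off p q = contradiction (h-inj (trans (sym (rest p q)) (trans (sym eq) to-a))) p
    ... | off p q | at-a = contradiction (h-inj (trans (sym (rest p q)) (trans eq to-b))) q
    ... | off p q | at-b = contradiction (h-inj (trans (sym (rest p q)) (trans eq to-a))) p
    ... | off p q | off r s = h-inj (trans (sym (rest p q)) (trans eq (rest r s)))

    d-irrefl : ∀ i → d i i ≡ false
    d-irrefl i rewrite <ᵇ-false (ℕₚ.n≮n (h i)) | <ᵇ-false (ℕₚ.n≮n (h′ i)) = ∧-zeroʳ (w i i)

    -- Exchanging `i` and `j` negates both comparisons, as distinct points have distinct heights
    -- before and after; the two negations cancel.
    d-sym : ∀ i j → d i j ≡ d j i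
    d-sym i j with i F.≟ j
    ... | yes refl = refl
    ... | no i≢j   = cong₂ _∧_ (w-sym i j) (xor≡false⇒≡ (begin
      ((h i <ᵇ h j) xor (h′ i <ᵇ h′ j)) xor ((h j <ᵇ h i) xor (h′ j <ᵇ h′ i)) ≡⟨ xor-interchange (h i <ᵇ h j) _ _ _ ⟩
      ((h i <ᵇ h j) xor (h j <ᵇ h i)) xor ((h′ i <ᵇ h′ j) xor (h′ j <ᵇ h′ i)) ≡⟨ cong₂ _xor_ (<ᵇ-antisym (i≢j ∘ h-inj)) (<ᵇ-antisym (i≢j ∘ h′-inj)) ⟩
      false                                                                   ∎))
      where open ≡-Reasoning

    d-off : ∀ i j → i ≢ a → i ≢ b → j ≢ a → j ≢ b → d i j ≡ false
    d-off i j i≢a i≢b j≢a j≢b rewrite rest i≢a i≢b | rest j≢a j≢b =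
      trans (cong (w i j ∧_) (xor-same (h i <ᵇ h j))) (∧-zeroʳ (w i j))

    dab : d a b ≡ w a b
    dab rewrite to-b | to-a = trans (cong (w a b ∧_) (<ᵇ-antisym (a≢b ∘ h-inj))) (∧-identityʳ _)

    difference : inversions w h xor inversions w h′ ≡ (⨁ (d a) xor ⨁ (d b)) xor w a b
    difference = begin
      inversions w h xor inversions w h′                                  ≡⟨ ⨁⨁-xor (λ i j → w i j ∧ (h i <ᵇ h j)) (λ i j → w i j ∧ (h′ i <ᵇ h′ j)) ⟨
      ⨁⨁ (λ i j → (w i j ∧ (h i <ᵇ h j)) xor (w i j ∧ (h′ i <ᵇ h′ j)))    ≡⟨ ⨁⨁-cong (λ i j → sym (∧-distribˡ-xor (w i j) _ _)) ⟩
      ⨁⨁ d                                                                ≡⟨ ⨁⨁-double-star d a≢b d-sym (d-irrefl a) (d-irrefl b) d-off ⟩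
      (⨁ (d a) xor ⨁ (d b)) xor d a b                                     ≡⟨ cong ((⨁ (d a) xor ⨁ (d b)) xor_) dab ⟩
      (⨁ (d a) xor ⨁ (d b)) xor w a b                                     ∎
      where open ≡-Reasoning

  -- For c other than a and b the pairs {a, c} and {b, c} change their
  -- inversion status together, so only the pair {a, b} contributes.
  inversions-twin-swap : (∀ c → c ≢ a → c ≢ b → w a c ≡ w b c) →
                         inversions w h xor inversions w h′ ≡ w a b
  inversions-twin-swap twins = trans difference (cong (_xor w a b) (begin
    ⨁ (d a) xor ⨁ (d b)                          ≡⟨ ⊕.∑-distrib-+ (d a) (d b) ⟨
    ⨁ (λ j → d a j xor d b j)                    ≡⟨ ⨁-pair _ a≢b cancel ⟩
    (d a a xor d b a) xor (d a b xor d b b)      ≡⟨ cong₂ (λ x y → (x xor d b a) xor (d a b xor y)) (d-irrefl a) (d-irrefl b) ⟩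
    d b a xor (d a b xor false)                  ≡⟨ cong₂ _xor_ (d-sym b a) (xor-identityʳ _) ⟩
    d a b xor d a b                              ≡⟨ xor-same (d a b) ⟩
    false                                        ∎))
    where
    open ≡-Reasoning
    cancel : ∀ j → j ≢ a → j ≢ b → d a j xor d b j ≡ false
    cancel j j≢a j≢b rewrite to-b | to-a | rest j≢a j≢b | twins j j≢a j≢b | xor-comm (h b <ᵇ h j) (h a <ᵇ h j) =
      xor-same (w b j ∧ ((h a <ᵇ h j) xor (h b <ᵇ h j)))

  -- When the lowest and the highest point trade places, every pair containing exactly one of them
  -- is reversed, so rows `a` and `b` of `d` become those of `w`.
  inversions-extremal-swap : (∀ i → w i i ≡ false) → w a b ≡ false →
                             h a ≡ 0 → (∀ i → h i ≤ h b) →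
                             inversions w h xor inversions w h′ ≡ ⨁ (w a) xor ⨁ (w b)
  inversions-extremal-swap w-irrefl wab ha≡0 ≤hb = begin
    inversions w h xor inversions w h′  ≡⟨ difference ⟩
    (⨁ (d a) xor ⨁ (d b)) xor w a b     ≡⟨ cong ((⨁ (d a) xor ⨁ (d b)) xor_) wab ⟩
    (⨁ (d a) xor ⨁ (d b)) xor false     ≡⟨ xor-identityʳ _ ⟩
    ⨁ (d a) xor ⨁ (d b)                 ≡⟨ cong₂ _xor_ (⊕.sum-cong-≗ da) (⊕.sum-cong-≗ db) ⟩
    ⨁ (w a) xor ⨁ (w b)                 ∎
    where
    open ≡-Reasoning
    above : ∀ {j} → j ≢ a → (h a <ᵇ h j) ≡ true
    above {j} j≢a = <ᵇ-true (ℕₚ.≤∧≢⇒< (subst (_≤ h j) (sym ha≡0) z≤n) (j≢a ∘ sym ∘ h-inj))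
    below : ∀ {j} → (h b <ᵇ h j) ≡ false
    below {j} = <ᵇ-false (≤⇒≯ (≤hb j))
    da : ∀ j → d a j ≡ w a j
    da j with position a b j
    ... | at-a = trans (d-irrefl a) (sym (w-irrefl a))
    ... | at-b = dab
    ... | off j≢a j≢b rewrite to-b | rest j≢a j≢b | above j≢a | below {j} = ∧-identityʳ _
    db : ∀ j → d b j ≡ w b j
    db j with position a b j
    ... | at-a = trans (d-sym b a) (trans dab (w-sym a b))
    ... | at-b = trans (d-irrefl b) (sym (w-irrefl b))
    ... | off j≢a j≢b rewrite to-a | rest j≢a j≢b | above j≢a | below {j} = ∧-identityʳ _

  -- No third point has a height between two consecutive ones, so the only pair to be reversed is
  -- that of `a` and `b`, and its weight is `false`.
  inversions-consecutive-swap : w a b ≡ false → h b ≡ suc (h a) →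
                                inversions w h ≡ inversions w h′
  inversions-consecutive-swap wab hb = ⨁⨁-cong same
    where
    wba : w b a ≡ false
    wba = trans (w-sym b a) wab
    up : ∀ {j} → j ≢ a → j ≢ b → (h a <ᵇ h j) ≡ (suc (h a) <ᵇ h j)
    up {j} j≢a j≢b with <-cmp (h a) (h j)
    ... | tri< lt _ _ = trans (<ᵇ-true lt) (sym (<ᵇ-true (ℕₚ.≤∧≢⇒< lt λ eq → j≢b (h-inj (sym (trans hb eq))))))
    ... | tri≈ _ eq _ = contradiction (h-inj (sym eq)) j≢a
    ... | tri> ¬lt _ _ = trans (<ᵇ-false ¬lt) (sym (<ᵇ-false (¬lt ∘ ℕₚ.<-trans (n<1+n _))))
    down : ∀ {i} → i ≢ a → (h i <ᵇ h a) ≡ (h i <ᵇ suc (h a))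
    down {i} i≢a with <-cmp (h i) (h a)
    ... | tri< lt _ _ = trans (<ᵇ-true lt) (sym (<ᵇ-true (m<n⇒m<1+n lt)))
    ... | tri≈ _ eq _ = contradiction (h-inj eq) i≢a
    ... | tri> ¬lt _ gt = trans (<ᵇ-false ¬lt) (sym (<ᵇ-false {h i} {suc (h a)} λ { (s≤s le) → ≤⇒≯ le gt }))
    same : ∀ i j → w i j ∧ (h i <ᵇ h j) ≡ w i j ∧ (h′ i <ᵇ h′ j)
    same i j with position a b i | position a b j
    ... | at-a | at-a = cong (w a a ∧_) (trans (<ᵇ-false (ℕₚ.n≮n (h a))) (sym (<ᵇ-false (ℕₚ.n≮n (h′ a)))))
    ... | at-b | at-b = cong (w b b ∧_) (trans (<ᵇ-false (ℕₚ.n≮n (h b))) (sym (<ᵇ-false (ℕₚ.n≮n (h′ b)))))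
    ... | at-a | at-b rewrite wab = refl
    ... | at-b | at-a rewrite wba = refl
    ... | at-a | off p q rewrite to-b | rest p q | hb = cong (w a j ∧_) (up p q)
    ... | at-b | off p q rewrite to-a | rest p q | hb = cong (w b j ∧_) (sym (up p q))
    ... | off p q | at-a rewrite to-b | rest p q | hb = cong (w i a ∧_) (down p)
    ... | off p q | at-b rewrite to-a | rest p q | hb = cong (w i b ∧_) (sym (down p))
    ... | off p q | off r s rewrite rest p q | rest r s = refl

-- Moves of the friends-and-strangers graph

⟨$⟩ˡ-injective : ∀ {n} (σ : Permutation′ n) {p q} → σ ⟨$⟩ˡ p ≡ σ ⟨$⟩ˡ q → p ≡ q
⟨$⟩ˡ-injective σ eq = trans (sym (inverseʳ σ)) (trans (cong (σ ⟨$⟩ʳ_) eq) (inverseʳ σ))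

⟨$⟩ʳ-injective : ∀ {n} (σ : Permutation′ n) {p q} → σ ⟨$⟩ʳ p ≡ σ ⟨$⟩ʳ q → p ≡ q
⟨$⟩ʳ-injective σ eq = trans (sym (inverseˡ σ)) (trans (cong (σ ⟨$⟩ˡ_) eq) (inverseˡ σ))

transpose-swapped : ∀ {n} (a b : Fin n) → Swapped (Perm.id ⟨$⟩ˡ_) (Perm.transpose a b ⟨$⟩ˡ_) a b
transpose-swapped a b = record { to-b = to-b ; to-a = to-a ; rest = rest }
  where
  to-b : Perm.transpose a b ⟨$⟩ˡ a ≡ b
  -- The inverse of `Perm.transpose a b` tests for `b` before `a`, which makes the case of equal
  -- points separate.
  to-b with a F.≟ b
  ... | yes a≡b = a≡b
  ... | no  _   rewrite dec-true (a F.≟ a) refl = refl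
  to-a : Perm.transpose a b ⟨$⟩ˡ b ≡ a
  to-a rewrite dec-true (b F.≟ b) refl = refl
  rest : ∀ {c} → c ≢ a → c ≢ b → Perm.transpose a b ⟨$⟩ˡ c ≡ c
  rest {c} c≢a c≢b rewrite dec-false (c F.≟ b) c≢b | dec-false (c F.≟ a) c≢a = refl

edge⇒≢ : ∀ {n} (X : Graph n) {u v} → Edge X u v → u ≢ v
edge⇒≢ X {u} e refl with trans (sym e) (Graph.irrefl X u)
... | ()

edge-sym : ∀ {n} (X : Graph n) {u v} → Edge X u v → Edge X v u
edge-sym X {u} {v} e = trans (Graph.sym X v u) e

-- A move seen from Y: σ ⟨$⟩ˡ p is the vertex of X occupied by p.
record Move {n} (X Y : Graph n) (σ ρ : Permutation′ n) : Set where
  field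
    a b   : Fin n
    edgeX : Edge X (σ ⟨$⟩ˡ a) (σ ⟨$⟩ˡ b)
    edgeY : Edge Y a b
    swap  : Swapped (σ ⟨$⟩ˡ_) (ρ ⟨$⟩ˡ_) a b

module _ {n} {X Y : Graph n} where

  adjacent⇒move : ∀ {σ ρ} → FSAdj X Y σ ρ → Move X Y σ ρ
  adjacent⇒move {σ} {ρ} (x , y , eX , eY , ρx , ρy , ρz) = record
    { a = σ ⟨$⟩ʳ x ; b = σ ⟨$⟩ʳ y
    ; edgeX = subst₂ (Edge X) (sym (inverseˡ σ)) (sym (inverseˡ σ)) eX
    ; edgeY = eY
    ; swap = record
      { to-b = trans (trans (cong (ρ ⟨$⟩ˡ_) (sym ρy)) (inverseˡ ρ)) (sym (inverseˡ σ))
      ; to-a = trans (trans (cong (ρ ⟨$⟩ˡ_) (sym ρx)) (inverseˡ ρ)) (sym (inverseˡ σ))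
      ; rest = λ {c} c≢a c≢b → trans
          (cong (ρ ⟨$⟩ˡ_) (sym (trans
            (ρz (σ ⟨$⟩ˡ c) (λ eq → c≢a (trans (sym (inverseʳ σ)) (cong (σ ⟨$⟩ʳ_) eq)))
                           (λ eq → c≢b (trans (sym (inverseʳ σ)) (cong (σ ⟨$⟩ʳ_) eq))))
            (inverseʳ σ))))
          (inverseˡ ρ)
      } }

  same-positions : ∀ {σ τ : Permutation′ n} → (∀ x → σ ⟨$⟩ʳ x ≡ τ ⟨$⟩ʳ x) → ∀ p → σ ⟨$⟩ˡ p ≡ τ ⟨$⟩ˡ p
  same-positions {σ} {τ} eq p = trans (sym (inverseˡ τ)) (cong (τ ⟨$⟩ˡ_) (trans (sym (eq _)) (inverseʳ σ)))

  -- A walk may end in `here` at a bijection that is only pointwise equal to the target; hence `I`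
  -- has to respect equality of positions.
  move-invariant : ∀ {B : Set} (I : Permutation′ n → B) →
                   (∀ {σ τ} → (∀ p → σ ⟨$⟩ˡ p ≡ τ ⟨$⟩ˡ p) → I σ ≡ I τ) →
                   (∀ {σ ρ} → Move X Y σ ρ → I σ ≡ I ρ) →
                   ∀ {σ τ} → FSWalk X Y σ τ → I σ ≡ I τ
  move-invariant I I-cong I-move (here {σ} {τ} eq) = I-cong (same-positions {σ} {τ} eq)
  move-invariant I I-cong I-move (step s w) = trans (I-move (adjacent⇒move s)) (move-invariant I I-cong I-move w)

  -- In one move a vertex of `Y` stays or crosses an edge of `X`, so its successive positions trace
  -- a walk in `X`.
  walk⇒walk : ∀ {σ τ} → FSWalk X Y σ τ → ∀ p → Walk (Edge X) (σ ⟨$⟩ˡ p) (τ ⟨$⟩ˡ p)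
  walk⇒walk (here {σ} {τ} eq) p = subst (Walk (Edge X) _) (same-positions {σ} {τ} eq p) here
  walk⇒walk {τ = τ} (step {σ} {ρ} s w) p with adjacent⇒move {σ} {ρ} s
  ... | record { a = a ; b = b ; edgeX = eX ; swap = swap } with position a b p
  ...   | at-a        = step eX (subst (λ z → Walk (Edge X) z (τ ⟨$⟩ˡ p)) (Swapped.to-b swap) (walk⇒walk w p))
  ...   | at-b        = step (edge-sym X eX) (subst (λ z → Walk (Edge X) z (τ ⟨$⟩ˡ p)) (Swapped.to-a swap) (walk⇒walk w p))
  ...   | off p≢a p≢b = subst (λ z → Walk (Edge X) z (τ ⟨$⟩ˡ p)) (Swapped.rest swap p≢a p≢b) (walk⇒walk w p)

  disconnected⇒FSDisconnected : Disconnected X → FSDisconnected X Y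
  -- The transposition carries the vertex labelled `u` from position `u` to position `v`.
  disconnected⇒FSDisconnected X-disc fs = X-disc λ u v →
    subst (Walk (Edge X) u) (Swapped.to-b (transpose-swapped u v)) (walk⇒walk (fs Perm.id (Perm.transpose u v)) u)

  -- Parity invariants: bipartite graphs, paths and cycles

  private
    heights-injective : ∀ (π σ : Permutation′ n) {p q} → toℕ (π ⟨$⟩ʳ (σ ⟨$⟩ˡ p)) ≡ toℕ (π ⟨$⟩ʳ (σ ⟨$⟩ˡ q)) → p ≡ q
    heights-injective π σ = ⟨$⟩ˡ-injective σ ∘ ⟨$⟩ʳ-injective π ∘ toℕ-injective

  -- A move flips the sign; it also flips `count`, because a vertex in `A` and one outside trade
  -- places of different colours. Exchanging `u` and `v`, which agree under `A`, flips the sign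
  -- alone.
  bipartite⇒FSDisconnected : Bipartite X → (A : Fin n → Bool) → (∀ {p q} → Edge Y p q → A p ≢ A q) →
                             ∀ {u v} → u ≢ v → A u ≡ A v → FSDisconnected X Y
  bipartite⇒FSDisconnected (f , f-proper) A A-proper {u} {v} u≢v Au≡Av fs
    = contradiction (trans (sym change) (trans (cong (I Perm.id xor_) (sym invariant)) (xor-same (I Perm.id)))) λ ()
    where
    sign count I : Permutation′ n → Bool
    sign σ  = inversions (λ _ _ → true) (λ p → toℕ (σ ⟨$⟩ˡ p))
    count σ = ⨁ (λ p → A p ∧ f (σ ⟨$⟩ˡ p))
    I σ     = sign σ xor count σ
    sign-change : ∀ {σ ρ a b} → a ≢ b → Swapped (σ ⟨$⟩ˡ_) (ρ ⟨$⟩ˡ_) a b → sign σ xor sign ρ ≡ true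
    sign-change {σ} a≢b swap = inversions-twin-swap (λ _ _ → true) (λ _ _ → refl) (⟨$⟩ˡ-injective σ ∘ toℕ-injective)
      a≢b (swapped-map toℕ swap) λ _ _ _ → refl
    count-change : ∀ {σ ρ a b} → a ≢ b → Swapped (σ ⟨$⟩ˡ_) (ρ ⟨$⟩ˡ_) a b →
                   count σ xor count ρ ≡ (A a xor A b) ∧ (f (σ ⟨$⟩ˡ a) xor f (σ ⟨$⟩ˡ b))
    count-change {σ} {ρ} {a} {b} a≢b swap = begin
      count σ xor count ρ                ≡⟨ ⊕.∑-distrib-+ (λ p → A p ∧ f (σ ⟨$⟩ˡ p)) (λ p → A p ∧ f (ρ ⟨$⟩ˡ p)) ⟨
      ⨁ g                                ≡⟨ ⨁-pair g a≢b (λ p p≢a p≢b → trans (cong (λ z → (A p ∧ f (σ ⟨$⟩ˡ p)) xor (A p ∧ f z)) (rest p≢a p≢b)) (xor-same (A p ∧ f (σ ⟨$⟩ˡ p)))) ⟩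
      g a xor g b                        ≡⟨ cong₂ (λ y z → ((A a ∧ f x) xor (A a ∧ f y)) xor ((A b ∧ f x′) xor (A b ∧ f z))) to-b to-a ⟩
      -- These four terms are the expansion of a product of two sums modulo 2.
      ((A a ∧ f x) xor (A a ∧ f x′)) xor ((A b ∧ f x′) xor (A b ∧ f x)) ≡⟨ product (A a) (A b) (f x) (f x′) ⟩
      (A a xor A b) ∧ (f x xor f x′)     ∎
      where
      open ≡-Reasoning
      open Swapped swap
      x x′ : Fin n
      x = σ ⟨$⟩ˡ a
      x′ = σ ⟨$⟩ˡ b
      g : Fin n → Bool
      g p = (A p ∧ f (σ ⟨$⟩ˡ p)) xor (A p ∧ f (ρ ⟨$⟩ˡ p))
      product : ∀ α β y z → ((α ∧ y) xor (α ∧ z)) xor ((β ∧ z) xor (β ∧ y)) ≡ (α xor β) ∧ (y xor z)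
      product false false _     _     = refl
      product false true  y     z     = xor-comm z y
      product true  false y     z     = xor-identityʳ (y xor z)
      product true  true  y     z     = trans (cong ((y xor z) xor_) (xor-comm z y)) (xor-same (y xor z))
    I-change : ∀ {σ ρ a b} → a ≢ b → Swapped (σ ⟨$⟩ˡ_) (ρ ⟨$⟩ˡ_) a b →
               I σ xor I ρ ≡ not ((A a xor A b) ∧ (f (σ ⟨$⟩ˡ a) xor f (σ ⟨$⟩ˡ b)))
    I-change {σ} {ρ} a≢b swap = trans (xor-interchange (sign σ) (count σ) (sign ρ) (count ρ))
      (cong₂ _xor_ (sign-change {σ} {ρ} a≢b swap) (count-change {σ} {ρ} a≢b swap))
    ≢⇒xor : ∀ {x y} → x ≢ y → x xor y ≡ true
    ≢⇒xor {true}  {true}  x≢y = contradiction refl x≢y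
    ≢⇒xor {true}  {false} x≢y = refl
    ≢⇒xor {false} {true}  x≢y = refl
    ≢⇒xor {false} {false} x≢y = contradiction refl x≢y
    I-move : ∀ {σ ρ} → Move X Y σ ρ → I σ ≡ I ρ
    I-move {σ} {ρ} m = xor≡false⇒≡ (trans (I-change {σ} {ρ} (edge⇒≢ Y edgeY) swap)
      (cong₂ (λ y z → not (y ∧ z)) (≢⇒xor (A-proper edgeY)) (≢⇒xor (f-proper _ _ edgeX))))
      where open Move m
    I-cong : ∀ {σ τ} → (∀ p → σ ⟨$⟩ˡ p ≡ τ ⟨$⟩ˡ p) → I σ ≡ I τ
    I-cong eq = cong₂ _xor_ (inversions-cong (λ _ _ → true) (cong toℕ ∘ eq)) (⊕.sum-cong-≗ λ p → cong (λ z → A p ∧ f z) (eq p))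
    invariant : I Perm.id ≡ I (Perm.transpose u v)
    invariant = move-invariant I (λ {σ} {τ} → I-cong {σ} {τ}) I-move (fs Perm.id (Perm.transpose u v))
    change : I Perm.id xor I (Perm.transpose u v) ≡ true
    change = trans (I-change {Perm.id} {Perm.transpose u v} u≢v (transpose-swapped u v))
      (cong (λ z → not (z ∧ (f u xor f v))) (trans (cong (_xor A v) Au≡Av) (xor-same (A v))))

  -- `w` selects pairs of nonadjacent vertices of `Y`, and `π` gives the order of `X` along the path
  -- or cycle. As `u` and `v` form a selected pair and are otherwise paired with the same vertices,
  -- exchanging them changes the parity.
  module _ (w : Fin n → Fin n → Bool) (w-sym : ∀ p q → w p q ≡ w q p)
           (w-independent : ∀ {p q} → Edge Y p q → w p q ≡ false)
           {u v : Fin n} (u≢v : u ≢ v) (wuv : w u v ≡ true)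
           (twins : ∀ c → c ≢ u → c ≢ v → w u c ≡ w v c)
           (π : Permutation′ n) where

    private
      h : Permutation′ n → Fin n → ℕ
      h σ p = toℕ (π ⟨$⟩ʳ (σ ⟨$⟩ˡ p))

      I : Permutation′ n → Bool
      I σ = inversions w (h σ)

      heights-swapped : ∀ {σ ρ a b} → Swapped (σ ⟨$⟩ˡ_) (ρ ⟨$⟩ˡ_) a b → Swapped (h σ) (h ρ) a b
      heights-swapped = swapped-map (toℕ ∘ (π ⟨$⟩ʳ_))

      I-move-consecutive : ∀ {σ ρ} (m : Move X Y σ ρ) →
                           PathAdj (π ⟨$⟩ʳ (σ ⟨$⟩ˡ Move.a m)) (π ⟨$⟩ʳ (σ ⟨$⟩ˡ Move.b m)) → I σ ≡ I ρ
      I-move-consecutive {σ} {ρ} m (inj₁ eq) = inversions-consecutive-swap w w-sym (heights-injective π σ)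
        (edge⇒≢ Y edgeY) (heights-swapped {σ} {ρ} swap) (w-independent edgeY) (sym eq)
        where open Move m
      I-move-consecutive {σ} {ρ} m (inj₂ eq) = inversions-consecutive-swap w w-sym (heights-injective π σ)
        (edge⇒≢ Y (edge-sym Y edgeY)) (swapped-sym (heights-swapped {σ} {ρ} swap)) (w-independent (edge-sym Y edgeY)) (sym eq)
        where open Move m

      not-invariant : (∀ {σ ρ} → Move X Y σ ρ → I σ ≡ I ρ) → FSDisconnected X Y
      not-invariant I-move fs = contradiction (trans (sym wuv) (trans
        (sym (inversions-twin-swap w w-sym (heights-injective π Perm.id) u≢v
          (heights-swapped {Perm.id} {Perm.transpose u v} (transpose-swapped u v)) twins))
        (trans (cong (I Perm.id xor_) (sym (move-invariant I (λ {σ} {τ} → I-cong {σ} {τ}) I-move (fs Perm.id (Perm.transpose u v))))) (xor-same (I Perm.id))))) λ ()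
        where
        I-cong : ∀ {σ τ} → (∀ p → σ ⟨$⟩ˡ p ≡ τ ⟨$⟩ˡ p) → I σ ≡ I τ
        I-cong {σ} {τ} eq = inversions-cong w {h σ} {h τ} λ p → cong (toℕ ∘ (π ⟨$⟩ʳ_)) (eq p)

    path⇒FSDisconnected : (∀ x y → Edge X x y → PathAdj (π ⟨$⟩ʳ x) (π ⟨$⟩ʳ y)) → FSDisconnected X Y
    path⇒FSDisconnected path = not-invariant λ m → I-move-consecutive m (path _ _ (Move.edgeX m))

    -- The closing edge joins the lowest and the highest position, so crossing it changes the parity
    -- by the sum of two rows of `w`; rows of equal sum cancel.
    cycle⇒FSDisconnected : (∀ x y → Edge X x y → CycleAdj (π ⟨$⟩ʳ x) (π ⟨$⟩ʳ y)) →
                           (∀ p → w p p ≡ false) → (∀ p q → ⨁ (w p) ≡ ⨁ (w q)) → FSDisconnected X Y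
    cycle⇒FSDisconnected cycle w-irrefl rows = not-invariant I-move
      where
      ≤-last : ∀ {x : Fin n} (y : Fin n) → suc (toℕ y) ≡ n → toℕ x ≤ toℕ y
      ≤-last {x} y eq = ℕₚ.≤-pred (subst (toℕ x <_) (sym eq) (toℕ<n x))
      I-move : ∀ {σ ρ} → Move X Y σ ρ → I σ ≡ I ρ
      I-move {σ} {ρ} m with cycle _ _ (Move.edgeX m)
      ... | inj₁ adj = I-move-consecutive m adj
      ... | inj₂ (inj₁ (first , last)) = xor≡false⇒≡ (trans
        (inversions-extremal-swap w w-sym (heights-injective π σ) (edge⇒≢ Y edgeY) (heights-swapped {σ} {ρ} swap)
          w-irrefl (w-independent edgeY) first (λ _ → ≤-last _ last))
        (trans (cong (_xor ⨁ (w b)) (rows a b)) (xor-same (⨁ (w b)))))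
        where open Move m
      ... | inj₂ (inj₂ (first , last)) = xor≡false⇒≡ (trans
        (inversions-extremal-swap w w-sym (heights-injective π σ) (edge⇒≢ Y (edge-sym Y edgeY)) (swapped-sym (heights-swapped {σ} {ρ} swap))
          w-irrefl (w-independent (edge-sym Y edgeY)) first (λ _ → ≤-last _ last))
        (trans (cong (_xor ⨁ (w a)) (rows b a)) (xor-same (⨁ (w a)))))
        where open Move m

-- Counting

module Σℕ = CommutativeMonoidSum ℕₚ.+-0-commutativeMonoid

⟦_⟧ : Bool → ℕ
⟦ b ⟧ = if b then 1 else 0

♯ : ∀ {n} → (Fin n → Bool) → ℕ
♯ P = Σℕ.sum (λ x → ⟦ P x ⟧)

♯-cong : ∀ {n} {P Q : Fin n → Bool} → (∀ x → P x ≡ Q x) → ♯ P ≡ ♯ Q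
♯-cong P≡Q = Σℕ.sum-cong-≗ (cong ⟦_⟧ ∘ P≡Q)

sum-mono-≤ : ∀ {n} {f g : Fin n → ℕ} → (∀ x → f x ≤ g x) → Σℕ.sum f ≤ Σℕ.sum g
sum-mono-≤ {zero}  f≤g = z≤n
sum-mono-≤ {suc n} f≤g = ℕₚ.+-mono-≤ (f≤g F.zero) (sum-mono-≤ (f≤g ∘ F.suc))

sum-mono-< : ∀ {n} {f g : Fin n → ℕ} → (∀ x → f x ≤ g x) → ∀ z → f z < g z → Σℕ.sum f < Σℕ.sum g
sum-mono-< f≤g F.zero    fz<gz = ℕₚ.+-mono-<-≤ fz<gz (sum-mono-≤ (f≤g ∘ F.suc))
sum-mono-< f≤g (F.suc z) fz<gz = ℕₚ.+-mono-≤-< (f≤g F.zero) (sum-mono-< (f≤g ∘ F.suc) z fz<gz)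

⟦⟧-mono : ∀ {b c} → (b ≡ true → c ≡ true) → ⟦ b ⟧ ≤ ⟦ c ⟧
⟦⟧-mono {false} b⇒c = z≤n
⟦⟧-mono {true}  b⇒c rewrite b⇒c refl = ℕₚ.≤-refl

♯-mono-< : ∀ {n} {P Q : Fin n → Bool} → (∀ x → P x ≡ true → Q x ≡ true) →
           ∀ z → P z ≡ false → Q z ≡ true → ♯ P < ♯ Q
♯-mono-< {P = P} {Q} P⊆Q z Pz Qz = sum-mono-< (λ x → ⟦⟧-mono (P⊆Q x)) z
  (subst₂ (λ b c → ⟦ b ⟧ < ⟦ c ⟧) (sym Pz) (sym Qz) ℕₚ.≤-refl)

-- Induction on `k`: deleting the first image from `P` lowers the count strictly and keeps the other
-- images.
♯-injection : ∀ {n k} (P : Fin n → Bool) (e : Fin k → Fin n) → (∀ {i j} → e i ≡ e j → i ≡ j) →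
              (∀ i → P (e i) ≡ true) → k ≤ ♯ P
♯-injection {k = zero}  P e e-inj Pe = z≤n
♯-injection {k = suc k} P e e-inj Pe = ℕₚ.≤-<-trans
  (♯-injection P∖e₀ (e ∘ F.suc) (λ eq → Finₚ.suc-injective (e-inj eq)) P∖e₀-e)
  (♯-mono-< P∖e₀⊆P (e F.zero) P∖e₀-e₀ (Pe F.zero))
  where
  P∖e₀ : _ → Bool
  P∖e₀ x = not (does (x F.≟ e F.zero)) ∧ P x
  P∖e₀⊆P : ∀ x → P∖e₀ x ≡ true → P x ≡ true
  P∖e₀⊆P x eq with does (x F.≟ e F.zero)
  ... | false = eq
  P∖e₀-e₀ : P∖e₀ (e F.zero) ≡ false
  P∖e₀-e₀ = cong (λ b → not b ∧ P (e F.zero)) (dec-true (e F.zero F.≟ e F.zero) refl)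
  P∖e₀-e : ∀ i → P∖e₀ (e (F.suc i)) ≡ true
  P∖e₀-e i = trans (cong (λ b → not b ∧ P (e (F.suc i))) (dec-false (e (F.suc i) F.≟ e F.zero) λ eq → contradiction (e-inj eq) λ ())) (Pe (F.suc i))

♯-permute : ∀ {n} (P : Fin n → Bool) (σ : Permutation′ n) → ♯ (λ p → P (σ ⟨$⟩ˡ p)) ≡ ♯ P
♯-permute P σ = sym (Σℕ.sum-permute (λ x → ⟦ P x ⟧) (Perm.flip σ))

♯-singleton : ∀ {n} (z : Fin n) → ♯ (λ x → does (x F.≟ z)) ≡ 1
♯-singleton {suc n} F.zero    = cong suc (Σℕ.sum-replicate-zero n)
♯-singleton {suc n} (F.suc z) = ♯-singleton z

degree≡♯ : ∀ {n} (X : Graph n) x → degree X x ≡ ♯ (adj X x)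
degree≡♯ X x = tabulate-sum (λ y → ⟦ adj X x y ⟧)
  where
  tabulate-sum : ∀ {m} (f : Fin m → ℕ) → sum (tabulate f) ≡ Σℕ.sum f
  tabulate-sum {zero}  f = refl
  tabulate-sum {suc m} f = cong (f F.zero +_) (tabulate-sum (f ∘ F.suc))

-- Without a second neighbour, the row of `x` would be the indicator of `y`, of count one.
other-neighbour : ∀ {n} (X : Graph n) {x y} → Edge X x y → degree X x ≢ 1 → Σ (Fin n) λ z → Edge X x z × z ≢ y
other-neighbour {n} X {x} {y} xy deg≢1 with any? (λ z → (adj X x z Bool.≟ true) ×-dec ¬? (z F.≟ y))
... | yes found = found
... | no  none  = contradiction (trans (degree≡♯ X x) (trans (♯-cong only-y) (♯-singleton y))) deg≢1
  where
  only-y : ∀ z → adj X x z ≡ does (z F.≟ y)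
  only-y z with z F.≟ y
  ... | yes refl = xy
  ... | no  z≢y  = ¬-not λ xz → none (z , xz , z≢y)

-- A third neighbour would give an injection of three elements into a neighbourhood of size two.
degree-2-neighbours : ∀ {n} (X : Graph n) {x y z} → degree X x ≡ 2 → Edge X x y → Edge X x z → y ≢ z →
                      ∀ {u} → Edge X x u → u ≡ y ⊎ u ≡ z
degree-2-neighbours {n} X {x} {y} {z} deg≡2 xy xz y≢z {u} xu with u F.≟ y | u F.≟ z
... | yes u≡y | _       = inj₁ u≡y
... | no _    | yes u≡z = inj₂ u≡z
... | no u≢y  | no u≢z  = contradiction
  (subst (3 ≤_) (trans (sym (degree≡♯ X x)) deg≡2) (♯-injection (adj X x) e e-inj edges)) (λ { (s≤s (s≤s ())) })
  where
  e : Fin 3 → Fin n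
  e F.zero                  = u
  e (F.suc F.zero)          = y
  e (F.suc (F.suc F.zero))  = z
  edges : ∀ i → Edge X x (e i)
  edges F.zero                  = xu
  edges (F.suc F.zero)          = xy
  edges (F.suc (F.suc F.zero))  = xz
  e-inj : ∀ {i j} → e i ≡ e j → i ≡ j
  e-inj {F.zero} {F.zero} _ = refl
  e-inj {F.zero} {F.suc F.zero} eq = contradiction eq u≢y
  e-inj {F.zero} {F.suc (F.suc F.zero)} eq = contradiction eq u≢z
  e-inj {F.suc F.zero} {F.zero} eq = contradiction (sym eq) u≢y
  e-inj {F.suc F.zero} {F.suc F.zero} _ = refl
  e-inj {F.suc F.zero} {F.suc (F.suc F.zero)} eq = contradiction eq y≢z
  e-inj {F.suc (F.suc F.zero)} {F.zero} eq = contradiction (sym eq) u≢z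
  e-inj {F.suc (F.suc F.zero)} {F.suc F.zero} eq = contradiction (sym eq) y≢z
  e-inj {F.suc (F.suc F.zero)} {F.suc (F.suc F.zero)} _ = refl

-- Bridges

-- Equality is included because edges may stay inside the two end levels.
Consecutive : ℕ → ℕ → Set
Consecutive l m = l ≡ m ⊎ (m ≡ suc l ⊎ l ≡ suc m)

consecutive-sym : ∀ {l m} → Consecutive l m → Consecutive m l
consecutive-sym (inj₁ eq)        = inj₁ (sym eq)
consecutive-sym (inj₂ (inj₁ eq)) = inj₂ (inj₂ eq)
consecutive-sym (inj₂ (inj₂ eq)) = inj₂ (inj₁ eq)

at-level : ∀ {n} → (Fin n → ℕ) → ℕ → Fin n → Bool
at-level ℓ m x = does (ℓ x ℕₚ.≟ m)

-- The i-th vertex of a k-bridge has level i (counted from 1); the vertices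
-- beyond its first and its last vertex have levels 0 and k + 1.
record Layering {n} (X : Graph n) (k : ℕ) : Set where
  field
    ℓ           : Fin n → ℕ
    ℓ≤1+k       : ∀ x → ℓ x ≤ suc k
    singletons  : ∀ {x y m} → suc m ≤ k → ℓ x ≡ suc m → ℓ y ≡ suc m → x ≡ y
    consecutive : ∀ {x y} → Edge X x y → Consecutive (ℓ x) (ℓ y)
    left        : Σ (Fin n) λ x → ℓ x ≡ 0
    right       : Σ (Fin n) λ x → ℓ x ≡ suc k
    -- For a class with at least `n ∸ k` members this says that it can fill both end levels.
    size        : k + (♯ (at-level ℓ 0) + ♯ (at-level ℓ (suc k))) ≤ n

-- The invariant of a layered graph

∧-true : ∀ {b c} → b ∧ c ≡ true → b ≡ true × c ≡ true
∧-true {true} eq = refl , eq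

<ᵇ-true⁻¹ : ∀ {x y} → (x <ᵇ y) ≡ true → x < y
<ᵇ-true⁻¹ {x} {y} eq with x <? y
... | yes x<y = x<y
... | no  x≮y = contradiction (trans (sym eq) (<ᵇ-false x≮y)) λ ()

-- A member p of the independent class T stands to the left if the members of
-- T at lower levels do not yet fill level 0.
module _ {n k} {X Y : Graph n} (layering : Layering X k) (T : Fin n → Bool)
         (T-independent : ∀ {p q} → T p ≡ true → T q ≡ true → ¬ Edge Y p q)
         (T-large : n ≤ k + ♯ T) where

  open Layering layering

  private
    α β : ℕ
    α = ♯ (at-level ℓ 0)
    β = ♯ (at-level ℓ (suc k))

    L : Permutation′ n → Fin n → ℕ
    L σ p = ℓ (σ ⟨$⟩ˡ p)

    below : Permutation′ n → ℕ → Fin n → Bool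
    below σ m q = T q ∧ (L σ q <ᵇ m)

    below-false : ∀ {b x m} → ¬ x < m → b ∧ (x <ᵇ m) ≡ false
    below-false {b} x≮m = trans (cong (b ∧_) (<ᵇ-false x≮m)) (∧-zeroʳ b)

    -- `T` has at least `α + β` members, and at most `β` of them fit into the last level.
    α≤below-right : ∀ σ → α ≤ ♯ (below σ (suc k))
    α≤below-right σ = ℕₚ.+-cancelʳ-≤ β α _ (begin
      α + β                                                    ≤⟨ ℕₚ.+-cancelˡ-≤ k _ _ (ℕₚ.≤-trans size T-large) ⟩
      ♯ T                                                      ≤⟨ sum-mono-≤ pointwise ⟩
      Σℕ.sum (λ q → ⟦ below σ (suc k) q ⟧ + ⟦ at-level (L σ) (suc k) q ⟧) ≡⟨ Σℕ.∑-distrib-+ (λ q → ⟦ below σ (suc k) q ⟧) _ ⟩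
      ♯ (below σ (suc k)) + ♯ (at-level (L σ) (suc k))         ≡⟨ cong (♯ (below σ (suc k)) +_) (♯-permute (at-level ℓ (suc k)) σ) ⟩
      ♯ (below σ (suc k)) + β                                  ∎)
      where
      open ℕₚ.≤-Reasoning
      pointwise : ∀ q → ⟦ T q ⟧ ≤ ⟦ below σ (suc k) q ⟧ + ⟦ at-level (L σ) (suc k) q ⟧
      pointwise q with T q | L σ q ℕₚ.≟ suc k
      ... | false | _      = z≤n
      ... | true  | yes eq rewrite dec-true (L σ q ℕₚ.≟ suc k) eq = ℕₚ.m≤n+m 1 _
      ... | true  | no neq rewrite <ᵇ-true (≤∧≢⇒< (ℓ≤1+k (σ ⟨$⟩ˡ q)) neq) = ℕₚ.m≤m+n 1 _

    -- For `m ≤ 1` all counted members stand in level 0, where `z` takes up a place without being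
    -- counted.
    below-left<α : ∀ σ m → m ≤ 1 → ∀ z → L σ z ≡ 0 → below σ m z ≡ false → ♯ (below σ m) < α
    below-left<α σ m m≤1 z Lz z-out = subst (♯ (below σ m) <_) (♯-permute (at-level ℓ 0) σ)
      (♯-mono-< (λ q eq → dec-true (L σ q ℕₚ.≟ 0) (ℕₚ.n<1⇒n≡0 (ℕₚ.<-≤-trans (<ᵇ-true⁻¹ (proj₂ (∧-true {T q} eq))) m≤1)))
                z z-out (dec-true (L σ z ℕₚ.≟ 0) Lz))

    module _ {p : Fin n} (p∈T : T p ≡ true) where

      I : Permutation′ n → Bool
      I σ = ♯ (below σ (L σ p)) <ᵇ α

      I-cong : ∀ {σ ρ} → (∀ q → T q ≡ true → L σ q ≡ L ρ q) → I σ ≡ I ρ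
      I-cong {σ} {ρ} same = cong (_<ᵇ α) (♯-cong pointwise)
        where
        pointwise : ∀ q → below σ (L σ p) q ≡ below ρ (L ρ p) q
        pointwise q with T q in Tq
        ... | false = refl
        ... | true  = cong₂ _<ᵇ_ (same q Tq) (same p p∈T)

      -- The count for `p` can change only if `p` itself advances or if `a` reaches the level of
      -- `p`. The first case is harmless in level 0 and in singleton levels; the second forces `p`
      -- into the last level, where `I` is always `false`.
      I-advance : ∀ {σ ρ a b} → Swapped (σ ⟨$⟩ˡ_) (ρ ⟨$⟩ˡ_) a b → T a ≡ true → T b ≡ false →
                  L σ b ≡ suc (L σ a) → I σ ≡ I ρ
      I-advance {σ} {ρ} {a} {b} swap Ta Tb Lb with p F.≟ a
      ... | yes refl = at-p (L σ p ℕₚ.≟ 0)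
        where
        open Swapped (swapped-map ℓ swap)
        Lρp : L ρ p ≡ suc (L σ p)
        Lρp = trans to-b Lb
        at-p : Dec (L σ p ≡ 0) → I σ ≡ I ρ
        -- Before the move the uncounted occupant of level 0 is `p`; afterwards it is `b`, which
        -- lies outside `T`.
        at-p (yes Lp≡0) = trans
          (<ᵇ-true (below-left<α σ (L σ p) (subst (_≤ 1) (sym Lp≡0) z≤n) p Lp≡0 (below-false (ℕₚ.n≮n (L σ p)))))
          (sym (<ᵇ-true (below-left<α ρ (L ρ p) (subst (_≤ 1) (sym (trans Lρp (cong suc Lp≡0))) ℕₚ.≤-refl)
            b (trans to-a Lp≡0) (cong (_∧ (L ρ b <ᵇ L ρ p)) Tb))))
        at-p (no Lp≢0) = cong (_<ᵇ α) (♯-cong pointwise)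
          where
          -- As `b` is one level higher, the level of `p` is at most `k`; not being 0, it is a
          -- singleton.
          alone : ∀ {q} → q ≢ p → L σ q ≢ L σ p
          alone {q} q≢p eq with L σ p in Lp
          ... | zero  = contradiction refl Lp≢0
          ... | suc m = q≢p (⟨$⟩ˡ-injective σ (singletons (ℕₚ.≤-pred (subst (_≤ suc k) Lb (ℓ≤1+k (σ ⟨$⟩ˡ b)))) eq Lp))
          pointwise : ∀ q → below σ (L σ p) q ≡ below ρ (L ρ p) q
          pointwise q with position p b q
          ... | at-a = trans (below-false (ℕₚ.n≮n (L σ p))) (sym (below-false (ℕₚ.n≮n (L ρ p))))
          ... | at-b rewrite Tb = refl
          ... | off q≢p q≢b rewrite rest q≢p q≢b | Lρp with <-cmp (L σ q) (L σ p)
          ...   | tri< lt _ _  = cong (T q ∧_) (trans (<ᵇ-true lt) (sym (<ᵇ-true (m<n⇒m<1+n lt))))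
          ...   | tri≈ _ eq _  = contradiction eq (alone q≢p)
          ...   | tri> ge _ gt = trans (below-false ge) (sym (below-false λ lt → ℕₚ.<⇒≱ lt gt))
      ... | no p≢a = other (L σ p ℕₚ.≟ suc (L σ a))
        where
        open Swapped (swapped-map ℓ swap)
        p≢b : p ≢ b
        p≢b refl = contradiction (trans (sym p∈T) Tb) λ ()
        Lρp : L ρ p ≡ L σ p
        Lρp = rest p≢a p≢b
        other : Dec (L σ p ≡ suc (L σ a)) → I σ ≡ I ρ
        other (yes eq) = trans (right-side σ Lp≡1+k) (sym (right-side ρ (trans Lρp Lp≡1+k)))
          where
          right-side : ∀ τ → L τ p ≡ suc k → I τ ≡ false
          right-side τ Lp = <ᵇ-false (≤⇒≯ (subst (λ m → α ≤ ♯ (below τ m)) (sym Lp) (α≤below-right τ)))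
          Lp≡1+k : L σ p ≡ suc k
          -- `p` and `b` are distinct and share a level, which therefore exceeds `k`.
          Lp≡1+k = ≤-antisym (ℓ≤1+k (σ ⟨$⟩ˡ p)) (subst (suc k ≤_) (sym eq) (ℕₚ.≰⇒> λ Lp≤k →
            p≢b (⟨$⟩ˡ-injective σ (singletons Lp≤k eq Lb))))
        other (no neq) = cong (_<ᵇ α) (♯-cong pointwise)
          where
          pointwise : ∀ q → below σ (L σ p) q ≡ below ρ (L ρ p) q
          pointwise q with position a b q
          ... | off q≢a q≢b rewrite rest q≢a q≢b | Lρp = refl
          ... | at-b rewrite Tb = refl
          ... | at-a rewrite Lρp | to-b | Lb with <-cmp (L σ a) (L σ p)
          ...   | tri< lt _ _  = cong (T a ∧_) (trans (<ᵇ-true lt) (sym (<ᵇ-true (≤∧≢⇒< lt (neq ∘ sym)))))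
          ...   | tri≈ ge _ _  = trans (below-false ge) (sym (below-false (ge ∘ ℕₚ.<-trans (n<1+n (L σ a)))))
          ...   | tri> ge _ _  = trans (below-false ge) (sym (below-false (ge ∘ ℕₚ.<-trans (n<1+n (L σ a)))))

      -- Two members of `T` never trade places, being nonadjacent. If only `b` is a member, the
      -- reverse of the move is an advance of `b`.
      I-ascend : ∀ {σ ρ a b} → Swapped (σ ⟨$⟩ˡ_) (ρ ⟨$⟩ˡ_) a b → Edge Y a b → L σ b ≡ suc (L σ a) → I σ ≡ I ρ
      I-ascend {σ} {ρ} {a} {b} swap ab Lb with T a in Ta | T b in Tb
      ... | true  | true  = contradiction ab (T-independent Ta Tb)
      ... | true  | false = I-advance {σ} {ρ} swap Ta Tb Lb
      ... | false | true  = sym (I-advance {ρ} {σ} (swapped-sym (swapped-reverse swap)) Tb Ta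
        (trans (cong ℓ to-b) (trans Lb (cong (suc ∘ ℓ) (sym to-a)))))
        where open Swapped swap
      ... | false | false = I-cong {σ} {ρ} λ q Tq → sym (cong ℓ (rest
        (λ { refl → contradiction (trans (sym Ta) Tq) λ () }) (λ { refl → contradiction (trans (sym Tb) Tq) λ () })))
        where open Swapped swap

      I-move : ∀ {σ ρ} → Move X Y σ ρ → I σ ≡ I ρ
      I-move {σ} {ρ} m with consecutive (Move.edgeX m)
      -- Trading places within one level changes no level at all.
      ... | inj₁ level = I-cong {σ} {ρ} same
        where
        open Move m
        open Swapped (swapped-map ℓ swap)
        same : ∀ q → T q ≡ true → L σ q ≡ L ρ q
        same q _ with position a b q
        ... | at-a = trans level (sym to-b)
        ... | at-b = trans (sym level) (sym to-a)
        ... | off q≢a q≢b = sym (rest q≢a q≢b)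
      ... | inj₂ (inj₁ up)   = I-ascend {σ} {ρ} swap edgeY up
        where open Move m
      ... | inj₂ (inj₂ down) = I-ascend {σ} {ρ} (swapped-sym swap) (edge-sym Y edgeY) down
        where open Move m

  -- `p` stands to the left when placed in level 0, but not when placed in level `suc k`.
  layering⇒FSDisconnected : ∀ {p} → T p ≡ true → FSDisconnected X Y
  layering⇒FSDisconnected {p} p∈T fs = contradiction (trans (sym I-left) (trans
    (move-invariant (I p∈T) (λ {σ} {τ} eq → I-cong p∈T {σ} {τ} λ q _ → cong ℓ (eq q)) (I-move p∈T) (fs (to (proj₁ left)) (to (proj₁ right))))
    I-right)) λ ()
    where
    to : Fin n → Permutation′ n
    to x = Perm.transpose p x
    at : ∀ x → to x ⟨$⟩ˡ p ≡ x
    at x = Swapped.to-b (transpose-swapped p x)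
    I-left : I p∈T (to (proj₁ left)) ≡ true
    I-left = <ᵇ-true (below-left<α σ (L σ p) (subst (_≤ 1) (sym Lp) z≤n) p Lp (below-false (ℕₚ.n≮n (L σ p))))
      where
      σ : Permutation′ n
      σ = to (proj₁ left)
      Lp : L σ p ≡ 0
      Lp = trans (cong ℓ (at _)) (proj₂ left)
    I-right : I p∈T (to (proj₁ right)) ≡ false
    I-right = <ᵇ-false (≤⇒≯ (subst (λ m → α ≤ ♯ (below σ m)) (sym (trans (cong ℓ (at _)) (proj₂ right))) (α≤below-right σ)))
      where
      σ : Permutation′ n
      σ = to (proj₁ right)

-- Layerings from bridges

walk-snoc : ∀ {n} {R : Fin n → Fin n → Set} {x y z} → Walk R x y → R y z → Walk R x z
walk-snoc here       r = step r here
walk-snoc (step s w) r = step s (walk-snoc w r)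

-- Finitely many doubly negated instances of excluded middle can be combined. Disconnectedness being
-- a negation, reachability may thus be taken as decidable when proving it.
¬¬-decidable : ∀ {n} (P : Fin n → Set) → ¬ ¬ (∀ x → Dec (P x))
¬¬-decidable P = Finₚ.sequence (RawMonad.rawApplicative ¬¬-Monad) λ _ → ¬¬-excluded-middle

module _ {n} (X : Graph n) {k : ℕ} (2≤k : 2 ≤ k) (v : ℕ → Fin n)
         (v-inj : ∀ i j → i < k → j < k → v i ≡ v j → i ≡ j)
         (cut : ∀ i → suc i < k → CutEdge X (v i) (v (suc i)))
         (inner : ∀ i → 0 < i → suc i < k → degree X (v i) ≡ 2)
         (first : degree X (v 0) ≢ 1) (last : degree X (v (k ∸ 1)) ≢ 1) where

  private
    -- Only the first edge of the bridge is deleted: its being a cut-edge and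
    -- the degree condition on the inner vertices suffice.
    Left : Fin n → Set
    Left = Walk (EdgeMinus X (v 0) (v 1)) (v 0)

    OffBridge : Fin n → Set
    OffBridge x = ∀ i → i < k → x ≢ v i

    0<k : 0 < k
    0<k = ℕₚ.<-trans z<s 2≤k

    extend : ∀ {x y} → Left x → OffBridge x → Edge X x y → Left y
    extend Lx clear e = walk-snoc Lx (e , λ { (inj₁ (eq , _)) → clear 0 0<k eq ; (inj₂ (eq , _)) → clear 1 2≤k eq })

    enter : ∀ {y} → Edge X (v 0) y → y ≢ v 1 → Left y
    enter e y≢v₁ = step (e , λ { (inj₁ (_ , eq)) → y≢v₁ eq ; (inj₂ (eq , _)) → contradiction (v-inj 0 1 0<k 2≤k eq) λ () }) here

    -- From a later bridge vertex a walk could return along the bridge to `v 1` without using the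
    -- first edge, which is a cut-edge.
    not-left : ∀ i → suc i < k → ¬ Left (v (suc i))
    not-left zero    1<k   = proj₂ (cut 0 1<k)
    not-left (suc i) 2+i<k Lv = not-left i (ℕₚ.<-trans (n<1+n _) 2+i<k)
      (walk-snoc Lv (edge-sym X (proj₁ (cut (suc i) 2+i<k)) , λ
        { (inj₁ (eq , _)) → contradiction (v-inj (suc (suc i)) 0 2+i<k 0<k eq) λ ()
        ; (inj₂ (_ , eq)) → contradiction (v-inj (suc i) 0 (ℕₚ.<-trans (n<1+n _) 2+i<k) 0<k eq) λ () }))

    inner-neighbour : ∀ i → suc (suc i) < k → ∀ {y} → Edge X (v (suc i)) y → y ≡ v i ⊎ y ≡ v (suc (suc i))
    inner-neighbour i lt = degree-2-neighbours X (inner (suc i) z<s lt)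
      (edge-sym X (proj₁ (cut i (ℕₚ.<-trans (n<1+n _) lt)))) (proj₁ (cut (suc i) lt))
      λ eq → contradiction (v-inj i (suc (suc i)) (ℕₚ.<-trans (ℕₚ.<-trans (n<1+n _) (n<1+n _)) lt) lt eq) (ℕₚ.m≢1+n+m i)

    -- A chord at `v 0` would make a later bridge vertex reachable without the first edge; at an
    -- inner vertex the degree leaves no room for one.
    no-chord : ∀ i j → i < j → j < k → Edge X (v i) (v j) → j ≡ suc i
    no-chord zero    (suc zero)    _   _   _ = refl
    no-chord zero    (suc (suc j)) _   j<k e = contradiction
      (enter e λ eq → contradiction (v-inj _ 1 j<k 2≤k eq) λ ()) (not-left (suc j) j<k)
    no-chord (suc i) j             i<j j<k e with inner-neighbour i (ℕₚ.≤-<-trans i<j j<k) e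
    ... | inj₁ eq = contradiction (v-inj j i j<k (ℕₚ.<-trans (n<1+n i) (ℕₚ.<-trans i<j j<k)) eq)
      λ { refl → ℕₚ.<-asym i<j (n<1+n i) }
    ... | inj₂ eq = v-inj j (suc (suc i)) j<k (ℕₚ.≤-<-trans i<j j<k) eq

    -- A relation rather than a function, so that matching reveals the vertex and its level
    -- together. Bridge indices start at 0 and levels on the bridge at 1.
    data Place : Fin n → ℕ → Set where
      on     : ∀ i → i < k → Place (v i) (suc i)
      before : ∀ {x} → OffBridge x → Left x → Place x 0
      after  : ∀ {x} → OffBridge x → ¬ Left x → Place x (suc k)

    on-before : ∀ {i y} → i < k → OffBridge y → Left y → Edge X (v i) y → i ≡ 0
    on-before {zero}  i<k clear Ly e = refl
    on-before {suc i} i<k clear Ly e = contradiction (extend Ly clear (edge-sym X e)) (not-left i i<k)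

    -- At `v 0` a neighbour off the bridge is in `Left`, and an inner vertex has only bridge
    -- neighbours; the last vertex remains.
    on-after : ∀ {i y} → i < k → OffBridge y → ¬ Left y → Edge X (v i) y → suc i ≡ k
    on-after {zero}  i<k clear ¬Ly e = contradiction (enter e (clear 1 2≤k)) ¬Ly
    on-after {suc i} i<k clear ¬Ly e = ≤-antisym i<k (ℕₚ.≮⇒≥ λ lt → neighbour-off lt (inner-neighbour i lt e))
      where
      neighbour-off : suc (suc i) < k → ¬ (_ ≡ v i ⊎ _ ≡ v (suc (suc i)))
      neighbour-off lt (inj₁ eq) = clear i (ℕₚ.<-trans (n<1+n i) i<k) eq
      neighbour-off lt (inj₂ eq) = clear _ lt eq

    on-consecutive : ∀ {i y m} → i < k → Place y m → Edge X (v i) y → Consecutive (suc i) m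
    on-consecutive {i} i<k (on j j<k) e with <-cmp i j
    ... | tri< lt _ _ = inj₂ (inj₁ (cong suc (no-chord i j lt j<k e)))
    ... | tri≈ _ eq _ = inj₁ (cong suc eq)
    ... | tri> _ _ gt = inj₂ (inj₂ (cong suc (no-chord j i gt i<k (edge-sym X e))))
    on-consecutive i<k (before clear Ly) e = inj₂ (inj₂ (cong suc (on-before i<k clear Ly e)))
    on-consecutive i<k (after clear ¬Ly) e = inj₂ (inj₁ (cong suc (sym (on-after i<k clear ¬Ly e))))

    place-consecutive : ∀ {x y l m} → Place x l → Place y m → Edge X x y → Consecutive l m
    place-consecutive (on i i<k)      q               e = on-consecutive i<k q e
    place-consecutive p               (on j j<k)      e = consecutive-sym (on-consecutive j<k p (edge-sym X e))
    place-consecutive (before _ _)    (before _ _)    e = inj₁ refl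
    place-consecutive (after _ _)     (after _ _)     e = inj₁ refl
    place-consecutive (before clear Lx) (after _ ¬Ly)   e = contradiction (extend Lx clear e) ¬Ly
    place-consecutive (after _ ¬Lx)   (before clear Ly) e = contradiction (extend Ly clear (edge-sym X e)) ¬Lx

    place-≤ : ∀ {x m} → Place x m → m ≤ suc k
    place-≤ (on i i<k)   = ℕₚ.m≤n⇒m≤1+n i<k
    place-≤ (before _ _) = z≤n
    place-≤ (after _ _)  = ℕₚ.≤-refl

    place-singleton : ∀ {x m} → Place x (suc m) → suc m ≤ k → x ≡ v m
    place-singleton (on i i<k)  _  = refl
    place-singleton (after _ _) lt = contradiction lt (ℕₚ.n≮n k)

    before-exists : ∀ {y m} → Place y m → Edge X (v 0) y → y ≢ v 1 → m ≡ 0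
    before-exists (on zero _)      e _     = contradiction refl (edge⇒≢ X e)
    before-exists (on (suc i) i<k) e y≢v₁ = contradiction (enter e y≢v₁) (not-left i i<k)
    before-exists (before _ _)     e _     = refl
    before-exists (after _ ¬Ly)    e y≢v₁ = contradiction (enter e y≢v₁) ¬Ly

    after-exists : ∀ {j y m} → suc (suc j) ≡ k → Place y m → Edge X (v (suc j)) y → y ≢ v j → m ≡ suc k
    after-exists {j} refl (on i i<k) e y≢vⱼ with <-cmp i (suc j)
    ... | tri< lt _ _   = contradiction (cong v (ℕₚ.suc-injective (sym (no-chord i (suc j) lt ℕₚ.≤-refl (edge-sym X e))))) y≢vⱼ
    ... | tri≈ _ refl _ = contradiction refl (edge⇒≢ X e)
    ... | tri> _ _ gt   = contradiction (ℕₚ.≤-pred i<k) (ℕₚ.<⇒≱ gt)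
    after-exists refl (before clear Ly) e _ = contradiction (on-before ℕₚ.≤-refl clear Ly e) λ ()
    after-exists refl (after _ _)     e _ = refl

    place-unique : ∀ {x l m} → Place x l → Place x m → l ≡ m
    place-unique p q = unique p q refl
      where
      unique : ∀ {x y l m} → Place x l → Place y m → x ≡ y → l ≡ m
      unique (on i i<k)      (on j j<k)      eq   = cong suc (v-inj i j i<k j<k eq)
      unique (on i i<k)      (before clear _)  eq   = contradiction (sym eq) (clear i i<k)
      unique (on i i<k)      (after clear _)   eq   = contradiction (sym eq) (clear i i<k)
      unique (before clear _)  (on j j<k)      eq   = contradiction eq (clear j j<k)
      unique (after clear _)   (on j j<k)      eq   = contradiction eq (clear j j<k)
      unique (before _ _)    (before _ _)    eq   = refl
      unique (after _ _)     (after _ _)     eq   = refl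
      unique (before _ Lx)   (after _ ¬Lx)   refl = contradiction Lx ¬Lx
      unique (after _ ¬Lx)   (before _ Lx)   refl = contradiction Lx ¬Lx

  bridge⇒layering : (∀ x → Dec (Left x)) → Layering X k
  bridge⇒layering left? = record
    { ℓ = ℓ
    ; ℓ≤1+k = λ x → place-≤ (placed x)
    ; singletons = λ le ℓx ℓy → trans (at le ℓx) (sym (at le ℓy))
    ; consecutive = λ e → place-consecutive (placed _) (placed _) e
    ; left = left
    ; right = right k refl
    ; size = size
    }
    where
    place : ∀ x → Σ ℕ (Place x)
    place x with any? (λ (i : Fin k) → v (toℕ i) F.≟ x)
    ... | yes (i , refl) = suc (toℕ i) , on (toℕ i) (toℕ<n i)
    ... | no  none with left? x
    ...   | yes Lx = 0 , before clear Lx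
      where
      clear : OffBridge x
      clear i i<k eq = none (F.fromℕ< i<k , trans (cong v (toℕ-fromℕ< i<k)) (sym eq))
    ...   | no ¬Lx = suc k , after clear ¬Lx
      where
      clear : OffBridge x
      clear i i<k eq = none (F.fromℕ< i<k , trans (cong v (toℕ-fromℕ< i<k)) (sym eq))
    ℓ : Fin n → ℕ
    ℓ x = proj₁ (place x)
    placed : ∀ x → Place x (ℓ x)
    placed x = proj₂ (place x)
    at : ∀ {x m} → suc m ≤ k → ℓ x ≡ suc m → x ≡ v m
    at {x} le eq = place-singleton (subst (Place x) eq (placed x)) le
    left : Σ (Fin n) λ x → ℓ x ≡ 0
    left with other-neighbour X (proj₁ (cut 0 2≤k)) first
    ... | y , e , y≢v₁ = y , before-exists (placed y) e y≢v₁
    -- `m` is a copy of `k` that can be matched without refining `k`; in the last case `m ∸ 1`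
    -- reduces to `suc j`.
    right : ∀ m → m ≡ k → Σ (Fin n) λ x → ℓ x ≡ suc k
    right zero          eq = contradiction (subst (2 ≤_) (sym eq) 2≤k) λ ()
    right (suc zero)    eq = contradiction (subst (2 ≤_) (sym eq) 2≤k) λ { (s≤s ()) }
    right (suc (suc j)) eq with other-neighbour X (edge-sym X (proj₁ (cut j (ℕₚ.≤-reflexive eq))))
                                  (subst (λ m → degree X (v (m ∸ 1)) ≢ 1) (sym eq) last)
    ... | y , e , y≢vⱼ = y , after-exists eq (placed y) e y≢vⱼ
    middle : Fin n → Bool
    middle x = not (at-level ℓ 0 x ∨ at-level ℓ (suc k) x)
    -- The two end levels and `middle` are disjoint, and `middle` contains the `k` bridge vertices.
    size : k + (♯ (at-level ℓ 0) + ♯ (at-level ℓ (suc k))) ≤ n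
    size = begin
      k + (♯ (at-level ℓ 0) + ♯ (at-level ℓ (suc k)))         ≤⟨ ℕₚ.+-monoˡ-≤ _ (♯-injection middle (v ∘ toℕ) (λ {i} {j} eq → toℕ-injective (v-inj _ _ (toℕ<n i) (toℕ<n j) eq)) middle-v) ⟩
      ♯ middle + (♯ (at-level ℓ 0) + ♯ (at-level ℓ (suc k)))  ≡⟨ cong (♯ middle +_) (Σℕ.∑-distrib-+ (λ x → ⟦ at-level ℓ 0 x ⟧) _) ⟨
      ♯ middle + Σℕ.sum (λ x → ⟦ at-level ℓ 0 x ⟧ + ⟦ at-level ℓ (suc k) x ⟧) ≡⟨ Σℕ.∑-distrib-+ (λ x → ⟦ middle x ⟧) _ ⟨
      Σℕ.sum (λ x → ⟦ middle x ⟧ + (⟦ at-level ℓ 0 x ⟧ + ⟦ at-level ℓ (suc k) x ⟧)) ≤⟨ sum-mono-≤ (λ x → exclusive (ℓ x)) ⟩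
      Σℕ.sum {n} (λ _ → 1)                                    ≡⟨ sum-ones n ⟩
      n                                                       ∎
      where
      open ℕₚ.≤-Reasoning
      sum-ones : ∀ m → Σℕ.sum {m} (λ _ → 1) ≡ m
      sum-ones zero    = refl
      sum-ones (suc m) = cong suc (sum-ones m)
      exclusive : ∀ m → ⟦ not (does (m ℕₚ.≟ 0) ∨ does (m ℕₚ.≟ suc k)) ⟧ + (⟦ does (m ℕₚ.≟ 0) ⟧ + ⟦ does (m ℕₚ.≟ suc k) ⟧) ≤ 1
      exclusive zero = ℕₚ.≤-refl
      exclusive (suc m) with does (m ℕₚ.≟ k)
      ... | true  = ℕₚ.≤-refl
      ... | false = ℕₚ.≤-refl
      middle-v : ∀ i → middle (v (toℕ i)) ≡ true
      middle-v i rewrite place-unique (placed (v (toℕ i))) (on (toℕ i) (toℕ<n i))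
                       | dec-false (toℕ i ℕₚ.≟ k) (ℕₚ.<⇒≢ (toℕ<n i)) = refl

bridge⇒FSDisconnected : ∀ {n k} {X Y : Graph n} → 2 ≤ k → HasBridge X k → (T : Fin n → Bool) →
                        (∀ {p q} → T p ≡ true → T q ≡ true → ¬ Edge Y p q) → n ≤ k + ♯ T →
                        ∀ {p} → T p ≡ true → FSDisconnected X Y
bridge⇒FSDisconnected 2≤k (inj₁ (refl , _)) _ _ _ _ = contradiction 2≤k λ { (s≤s ()) }
bridge⇒FSDisconnected {X = X} 2≤k (inj₂ (_ , v , v-inj , cut , inner , first , last)) T T-independent T-large p∈T fs =
  ¬¬-decidable (Walk (EdgeMinus X (v 0) (v 1)) (v 0)) λ left? →
    layering⇒FSDisconnected (bridge⇒layering X 2≤k v v-inj cut inner first last left?) T T-independent T-large p∈T fs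

-- Complete multipartite graphs

K-edge⇒class≢ : ∀ {t} (ks : Vec ℕ t) {u v} → Edge (K ks) u v → classOf ks u ≢ classOf ks v
K-edge⇒class≢ ks {u} {v} e with classOf ks u F.≟ classOf ks v
... | no  neq = neq

module _ {n} {C : Set} {X Y : Graph n} (class : Fin n → C)
         (Y-proper : ∀ {p q} → Edge Y p q → class p ≢ class q) (X-cycle : IsCycle X) where

  -- The weight is `s` without its diagonal, so `s p p xor ⨁ (s p)` is the row sum of the weight at
  -- `p`; the constant `r` makes all rows agree.
  cycle-relation⇒FSDisconnected :
    (s : Fin n → Fin n → Bool) → (∀ p q → s p q ≡ s q p) → (∀ {p q} → s p q ≡ true → class p ≡ class q) →
    ∀ {u v} → u ≢ v → s u v ≡ true → (∀ c → s u c ≡ s v c) →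
    ∀ {r} → (∀ p → s p p xor ⨁ (s p) ≡ r) → FSDisconnected X Y
  cycle-relation⇒FSDisconnected s s-sym s-class {u} {v} u≢v suv twins {r} rows =
    cycle⇒FSDisconnected w w-sym w-independent u≢v wuv w-twins (proj₁ X-cycle)
      (λ x y → Equivalence.to (proj₂ X-cycle x y)) w-irrefl
      (λ p q → trans (w-row p) (sym (w-row q)))
    where
    w : Fin n → Fin n → Bool
    w p q = not (does (q F.≟ p)) ∧ s p q
    w-off : ∀ {p q} → q ≢ p → w p q ≡ s p q
    w-off {p} {q} q≢p = cong (λ e → not e ∧ s p q) (dec-false (q F.≟ p) q≢p)
    w-irrefl : ∀ p → w p p ≡ false
    w-irrefl p = cong (λ e → not e ∧ s p p) (dec-true (p F.≟ p) refl)
    w-sym : ∀ p q → w p q ≡ w q p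
    w-sym p q = by-cases (p F.≟ q)
      where
      by-cases : Dec (p ≡ q) → w p q ≡ w q p
      by-cases (yes p≡q) = cong₂ w p≡q (sym p≡q)
      by-cases (no  p≢q) = trans (w-off (p≢q ∘ sym)) (trans (s-sym p q) (sym (w-off p≢q)))
    w-independent : ∀ {p q} → Edge Y p q → w p q ≡ false
    w-independent {p} {q} e = ¬-not λ eq → Y-proper e (s-class (proj₂ (∧-true {not (does (q F.≟ p))} eq)))
    wuv : w u v ≡ true
    wuv = trans (w-off (u≢v ∘ sym)) suv
    w-twins : ∀ c → c ≢ u → c ≢ v → w u c ≡ w v c
    w-twins c c≢u c≢v = trans (w-off c≢u) (trans (twins c) (sym (w-off c≢v)))
    w-row : ∀ p → ⨁ (w p) ≡ r
    w-row p = trans (sym (xor-cancelˡ (s p p) _)) (trans (cong (s p p xor_) (sym (⨁-remove (s p) p))) (rows p))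

  -- The cyclic order of three pairwise nonadjacent vertices of Y is invariant.
  cycle-triple⇒FSDisconnected : ∀ {a b c} → a ≢ b → a ≢ c → b ≢ c → class b ≡ class a → class c ≡ class a →
                                FSDisconnected X Y
  cycle-triple⇒FSDisconnected {a} {b} {c} a≢b a≢c b≢c cb cc =
    cycle-relation⇒FSDisconnected (λ p q → T p ∧ T q) (λ p q → ∧-comm (T p) (T q))
      (λ eq → let (Tp , Tq) = ∧-true eq in trans (T-class Tp) (sym (T-class Tq)))
      a≢b (cong₂ _∧_ Ta Tb) (λ d → cong (_∧ T d) (trans Ta (sym Tb))) rows
    where
    is : Fin n → Fin n → Bool
    is d q = does (q F.≟ d)
    T : Fin n → Bool
    -- For distinct vertices this is the indicator of the triple, in a form whose sum splits into
    -- three.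
    T q = is a q xor (is b q xor is c q)
    Ta : T a ≡ true
    Ta rewrite dec-true (a F.≟ a) refl | dec-false (a F.≟ b) a≢b | dec-false (a F.≟ c) a≢c = refl
    Tb : T b ≡ true
    Tb rewrite dec-true (b F.≟ b) refl | dec-false (b F.≟ a) (a≢b ∘ sym) | dec-false (b F.≟ c) b≢c = refl
    T-class : ∀ {q} → T q ≡ true → class q ≡ class a
    T-class {q} Tq with q F.≟ a | q F.≟ b | q F.≟ c
    ... | yes refl | _        | _        = refl
    ... | no _     | yes refl | _        = cb
    ... | no _     | no _     | yes refl = cc
    ⨁-is : ∀ d → ⨁ (is d) ≡ true
    ⨁-is d = trans (⨁-single (is d) d λ q → dec-false (q F.≟ d)) (dec-true (d F.≟ d) refl)
    ⨁T : ⨁ T ≡ true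
    ⨁T = trans (⊕.∑-distrib-+ (is a) _) (cong₂ _xor_ (⨁-is a) (trans (⊕.∑-distrib-+ (is b) (is c)) (cong₂ _xor_ (⨁-is b) (⨁-is c))))
    -- A member of the triple lies in two selected pairs, any other vertex in none.
    rows : ∀ p → (T p ∧ T p) xor ⨁ (λ q → T p ∧ T q) ≡ false
    rows p with T p
    ... | true  = cong not ⨁T
    ... | false = ⨁-zero {n} λ _ → refl

-- The last class and the sizes of the classes

last-member : ∀ {t} (ks : Vec ℕ (suc t)) → Fin (lastV ks) → Fin (sum ks)
last-member (k ∷ [])      i = i F.↑ˡ 0
last-member (k ∷ k′ ∷ ks) i = k F.↑ʳ last-member (k′ ∷ ks) i

last-member-injective : ∀ {t} (ks : Vec ℕ (suc t)) {i j} → last-member ks i ≡ last-member ks j → i ≡ j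
last-member-injective (k ∷ [])      eq = ↑ˡ-injective 0 _ _ eq
last-member-injective (k ∷ k′ ∷ ks) eq = last-member-injective (k′ ∷ ks) (↑ʳ-injective k _ _ eq)

last-member-class : ∀ {t} (ks : Vec ℕ (suc t)) i → classOf ks (last-member ks i) ≡ F.fromℕ t
last-member-class (k ∷ [])      i rewrite splitAt-↑ˡ k i 0 = refl
last-member-class (k ∷ k′ ∷ ks) i rewrite splitAt-↑ʳ k (sum (k′ ∷ ks)) (last-member (k′ ∷ ks) i) =
  cong F.suc (last-member-class (k′ ∷ ks) i)

lastV≡lookup : ∀ {t} (ks : Vec ℕ (suc t)) → lastV ks ≡ lookup ks (F.fromℕ t)
lastV≡lookup (k ∷ [])      = refl
lastV≡lookup (k ∷ k′ ∷ ks) = lastV≡lookup (k′ ∷ ks)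

gcdV∣lookup : ∀ {t} (ks : Vec ℕ t) i → gcdV ks ∣ lookup ks i
gcdV∣lookup (k ∷ ks) F.zero    = gcd[m,n]∣m k (gcdV ks)
gcdV∣lookup (k ∷ ks) (F.suc i) = ∣-trans (gcd[m,n]∣n k (gcdV ks)) (gcdV∣lookup ks i)

lastV≤sum : ∀ {t} (ks : Vec ℕ t) → lastV ks ≤ sum ks
lastV≤sum []            = z≤n
lastV≤sum (k ∷ [])      = ℕₚ.m≤m+n k 0
lastV≤sum (k ∷ k′ ∷ ks) = ℕₚ.≤-trans (lastV≤sum (k′ ∷ ks)) (ℕₚ.m≤n+m _ k)

-- The row of `p` counts the members of its class, and there are two of them.
pairs-row : ∀ {t} (ks : Vec ℕ t) → (∀ i → lookup ks i ≡ 2) → ∀ p →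
            ⨁ (λ q → does (classOf ks p F.≟ classOf ks q)) ≡ false
pairs-row (k ∷ ks) all≡2 p with all≡2 F.zero
pairs-row (_ ∷ ks) all≡2 F.zero            | refl = cong (not ∘ not) (⨁-zero {sum ks} λ _ → refl)
pairs-row (_ ∷ ks) all≡2 (F.suc F.zero)    | refl = cong (not ∘ not) (⨁-zero {sum ks} λ _ → refl)
pairs-row (_ ∷ ks) all≡2 (F.suc (F.suc p)) | refl = pairs-row ks (all≡2 ∘ F.suc) p

module _ {t} (ks : Vec ℕ (suc t)) where

  private
    same : Fin (sum ks) → Fin (sum ks) → Bool
    same p q = does (classOf ks p F.≟ classOf ks q)

    last-members : ∀ i j → classOf ks (last-member ks i) ≡ classOf ks (last-member ks j)
    last-members i j = trans (last-member-class ks i) (sym (last-member-class ks j))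

    same-class : ∀ {p q} → same p q ≡ true → classOf ks p ≡ classOf ks q
    same-class {p} {q} eq with classOf ks p F.≟ classOf ks q
    ... | yes c = c

    same-sym : ∀ p q → same p q ≡ same q p
    same-sym p q with classOf ks p F.≟ classOf ks q
    ... | yes eq = sym (dec-true (_ F.≟ _) (sym eq))
    ... | no neq = sym (dec-false (_ F.≟ _) (neq ∘ sym))

  last-pair : 2 ≤ lastV ks → Σ (Fin (sum ks)) λ u → Σ (Fin (sum ks)) λ v → u ≢ v × classOf ks u ≡ classOf ks v
  last-pair 2≤m = last-member ks i , last-member ks j
    , (λ eq → contradiction (fromℕ<-injective 0 1 (ℕₚ.<-trans z<s 2≤m) 2≤m (last-member-injective ks eq)) λ ())
    , last-members i j
    where
    i j : Fin (lastV ks)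
    i = F.fromℕ< (ℕₚ.<-trans z<s 2≤m)
    j = F.fromℕ< 2≤m

  -- All pairs within a class are selected; two members of one class are then twins.
  K-path : ∀ {X} → 2 ≤ lastV ks → IsPath X → FSDisconnected X (K ks)
  K-path 2≤m (π , X-path) with last-pair 2≤m
  ... | u , v , u≢v , cu≡cv = path⇒FSDisconnected same
    same-sym
    (λ e → dec-false (_ F.≟ _) (K-edge⇒class≢ ks e))
    u≢v (dec-true (_ F.≟ _) cu≡cv) (λ c _ _ → cong (λ z → does (z F.≟ classOf ks c)) cu≡cv)
    π (λ x y → Equivalence.to (X-path x y))

  K-cycle : ∀ {X} → 2 < lastV ks ⊎ (∀ i → lookup ks i ≡ 2) → IsCycle X → FSDisconnected X (K ks)
  K-cycle (inj₁ 3≤m) X-cycle = cycle-triple⇒FSDisconnected (classOf ks) (K-edge⇒class≢ ks) X-cycle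
    (distinct i≢j) (distinct i≢l) (distinct j≢l) (last-members j i) (last-members l i)
    where
    0<m : 0 < lastV ks
    0<m = ℕₚ.<-trans z<s 3≤m
    1<m : 1 < lastV ks
    1<m = ℕₚ.<-trans (n<1+n 1) 3≤m
    i j l : Fin (lastV ks)
    i = F.fromℕ< 0<m
    j = F.fromℕ< 1<m
    l = F.fromℕ< 3≤m
    distinct : ∀ {x y} → x ≢ y → last-member ks x ≢ last-member ks y
    distinct x≢y = x≢y ∘ last-member-injective ks
    i≢j : i ≢ j
    i≢j eq = contradiction (fromℕ<-injective 0 1 0<m 1<m eq) λ ()
    i≢l : i ≢ l
    i≢l eq = contradiction (fromℕ<-injective 0 2 0<m 3≤m eq) λ ()
    j≢l : j ≢ l
    j≢l eq = contradiction (fromℕ<-injective 1 2 1<m 3≤m eq) λ ()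
  K-cycle (inj₂ all≡2) X-cycle with last-pair (ℕₚ.≤-reflexive (sym (trans (lastV≡lookup ks) (all≡2 _))))
  ... | u , v , u≢v , cu≡cv = cycle-relation⇒FSDisconnected (classOf ks) (K-edge⇒class≢ ks) X-cycle
    same same-sym same-class u≢v (dec-true (_ F.≟ _) cu≡cv) (λ c → cong (λ z → does (z F.≟ classOf ks c)) cu≡cv)
    -- With classes of size two every vertex lies in exactly one selected pair, so the common row
    -- sum is `true`.
    (λ p → cong₂ _xor_ (dec-true (classOf ks p F.≟ classOf ks p) refl) (pairs-row ks all≡2 p))

  -- The independent class is the last one, and the bridge has as many vertices as there are outside
  -- that class.
  K-bridge : ∀ {X} → 1 ≤ lastV ks → 2 ≤ sum ks ∸ lastV ks → HasBridge X (sum ks ∸ lastV ks) → FSDisconnected X (K ks)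
  K-bridge 1≤m 2≤k bridge = bridge⇒FSDisconnected 2≤k bridge T
    (λ Tp Tq e → K-edge⇒class≢ ks e (trans (T-class Tp) (sym (T-class Tq))))
    (ℕₚ.≤-trans (ℕₚ.≤-reflexive (sym (ℕₚ.m∸n+n≡m (lastV≤sum ks))))
      (ℕₚ.+-monoʳ-≤ (sum ks ∸ lastV ks) (♯-injection T (last-member ks) (last-member-injective ks) T-last)))
    (T-last (F.fromℕ< 1≤m))
    where
    T : Fin (sum ks) → Bool
    T p = does (classOf ks p F.≟ F.fromℕ t)
    T-last : ∀ i → T (last-member ks i) ≡ true
    T-last i = dec-true (_ F.≟ _) (last-member-class ks i)
    T-class : ∀ {p} → T p ≡ true → classOf ks p ≡ F.fromℕ t
    T-class {p} eq with classOf ks p F.≟ F.fromℕ t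
    ... | yes c = c

  -- If no class exceeds size two, a common divisor above one excludes size one.
  large-or-pairs : (∀ i → 1 ≤ lookup ks i) → (∀ i j → i F.≤ j → lookup ks i ≤ lookup ks j) →
                   2 < lastV ks ⊎ 1 < gcdV ks → 2 < lastV ks ⊎ (∀ i → lookup ks i ≡ 2)
  large-or-pairs pos mono (inj₁ 2<m) = inj₁ 2<m
  large-or-pairs pos mono (inj₂ 1<g) with 2 <? lastV ks
  ... | yes 2<m = inj₁ 2<m
  ... | no  2≮m = inj₂ λ i → ≤-antisym (≤2 i) (≤∧≢⇒< (pos i) (≢1 i ∘ sym))
    where
    ≤2 : ∀ i → lookup ks i ≤ 2
    ≤2 i = ℕₚ.≤-trans (mono i (F.fromℕ t) (≤fromℕ i)) (subst (_≤ 2) (lastV≡lookup ks) (ℕₚ.≮⇒≥ 2≮m))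
    ≢1 : ∀ i → lookup ks i ≢ 1
    ≢1 i eq = ℕₚ.<⇒≢ 1<g (sym (∣1⇒≡1 (subst (gcdV ks ∣_) eq (gcdV∣lookup ks i))))

large-or-pair-last : ∀ {t} (ks : Vec ℕ (suc t)) → 2 < lastV ks ⊎ (∀ i → lookup ks i ≡ 2) → 1 ≤ lastV ks
large-or-pair-last ks (inj₁ 2<m) = ℕₚ.≤-trans (s≤s z≤n) 2<m
large-or-pair-last ks (inj₂ all≡2) = subst (1 ≤_) (sym (trans (lastV≡lookup ks) (all≡2 _))) (s≤s z≤n)

theorem1p4 : (t : ℕ) (ks : Vec ℕ t) → 2 ≤ t →
    (∀ i → 1 ≤ lookup ks i) →
    (∀ (i j : Fin t) → i F.≤ j → lookup ks i ≤ lookup ks j) →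
    4 ≤ sum ks →
    (X : Graph (sum ks)) →
    (t ≡ 2 → 2 ≤ firstV ks →
    (Disconnected X ⊎ Bipartite X ⊎ IsCycle X ⊎ HasBridge X (firstV ks)) →
    FSDisconnected X (K ks))
    × (2 < t → (2 < lastV ks ⊎ 1 < gcdV ks) →
    (Disconnected X ⊎ IsCycle X ⊎ HasBridge X (sum ks ∸ lastV ks)) →
    FSDisconnected X (K ks))
    × (2 < t → firstV ks ≡ 1 → lastV ks ≡ 2 →
    (Disconnected X ⊎ IsPath X) →
    FSDisconnected X (K ks))
theorem1p4 t ks 2≤t pos mono 4≤n X = bipartite ks pos mono X , multipartite ks pos mono X , path ks X
  where
  Positive Monotone : ∀ {t} → Vec ℕ t → Set
  Positive ks = ∀ i → 1 ≤ lookup ks i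
  Monotone ks = ∀ i j → i F.≤ j → lookup ks i ≤ lookup ks j

  bipartite : ∀ {t} (ks : Vec ℕ t) → Positive ks → Monotone ks → ∀ X → t ≡ 2 → 2 ≤ firstV ks →
              Disconnected X ⊎ Bipartite X ⊎ IsCycle X ⊎ HasBridge X (firstV ks) → FSDisconnected X (K ks)
  bipartite ks pos mono X refl 2≤k (inj₁ X-disc) = disconnected⇒FSDisconnected X-disc
  bipartite ks@(k ∷ l ∷ []) pos mono X refl 2≤k (inj₂ (inj₁ X-bip))
    with last-pair ks (ℕₚ.≤-trans 2≤k (mono F.zero (F.suc F.zero) z≤n))
  ... | u , v , u≢v , cu≡cv = bipartite⇒FSDisconnected X-bip (first ∘ classOf ks)
    (λ e → K-edge⇒class≢ ks e ∘ first-injective _ _) u≢v (cong first cu≡cv)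
    where
    first : Fin 2 → Bool
    first F.zero    = true
    first (F.suc _) = false
    first-injective : ∀ i j → first i ≡ first j → i ≡ j
    first-injective F.zero         F.zero         _ = refl
    first-injective (F.suc F.zero) (F.suc F.zero) _ = refl
  bipartite ks@(k ∷ l ∷ []) pos mono X refl 2≤k (inj₂ (inj₂ (inj₁ X-cycle))) = K-cycle ks large-or-pairs′ X-cycle
    where
    k≤l : k ≤ l
    k≤l = mono F.zero (F.suc F.zero) z≤n
    large-or-pairs′ : 2 < l ⊎ (∀ i → lookup ks i ≡ 2)
    large-or-pairs′ with 2 <? l
    ... | yes 2<l = inj₁ 2<l
    ... | no  2≮l = inj₂ λ
      { F.zero         → ≤-antisym (ℕₚ.≤-trans k≤l (ℕₚ.≮⇒≥ 2≮l)) 2≤k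
      ; (F.suc F.zero) → ≤-antisym (ℕₚ.≮⇒≥ 2≮l) (ℕₚ.≤-trans 2≤k k≤l) }
  bipartite ks@(k ∷ l ∷ []) pos mono X refl 2≤k (inj₂ (inj₂ (inj₂ X-bridge))) =
    K-bridge ks (pos (F.suc F.zero)) (subst (2 ≤_) k≡n∸l 2≤k) (subst (HasBridge X) k≡n∸l X-bridge)
    where
    k≡n∸l : k ≡ sum ks ∸ l
    -- `sum ks` unfolds to `k + (l + 0)`.
    k≡n∸l = sym (trans (cong (λ m → k + m ∸ l) (ℕₚ.+-identityʳ l)) (ℕₚ.m+n∸n≡m k l))

  multipartite : ∀ {t} (ks : Vec ℕ t) → Positive ks → Monotone ks → ∀ X → 2 < t → 2 < lastV ks ⊎ 1 < gcdV ks →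
                 Disconnected X ⊎ IsCycle X ⊎ HasBridge X (sum ks ∸ lastV ks) → FSDisconnected X (K ks)
  multipartite ks pos mono X _ _ (inj₁ X-disc) = disconnected⇒FSDisconnected X-disc
  multipartite ks@(_ ∷ _) pos mono X _ h (inj₂ (inj₁ X-cycle)) = K-cycle ks (large-or-pairs ks pos mono h) X-cycle
  multipartite ks@(k ∷ l ∷ m ∷ ms) pos mono X _ h (inj₂ (inj₂ X-bridge)) =
    K-bridge ks (large-or-pair-last ks (large-or-pairs ks pos mono h)) 2≤n∸last X-bridge
    where
    2≤n∸last : 2 ≤ sum ks ∸ lastV ks
    2≤n∸last = begin
      -- With more than two classes, the first two are not the last and contribute at least one
      -- vertex each.
      2                                                         ≤⟨ ℕₚ.+-mono-≤ (pos F.zero) (pos (F.suc F.zero)) ⟩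
      k + l                                                     ≡⟨ ℕₚ.m+n∸n≡m (k + l) (lastV ks) ⟨
      k + l + lastV ks ∸ lastV ks                               ≤⟨ ℕₚ.∸-monoˡ-≤ (lastV ks) (ℕₚ.+-monoʳ-≤ (k + l) (lastV≤sum (m ∷ ms))) ⟩
      k + l + sum (m ∷ ms) ∸ lastV ks                           ≡⟨ cong (_∸ lastV ks) (ℕₚ.+-assoc k l _) ⟩
      sum ks ∸ lastV ks                                         ∎
      where open ℕₚ.≤-Reasoning
  multipartite (_ ∷ [])     pos mono X (s≤s ())
  multipartite (_ ∷ _ ∷ []) pos mono X (s≤s (s≤s ()))

  path : ∀ {t} (ks : Vec ℕ t) X → 2 < t → firstV ks ≡ 1 → lastV ks ≡ 2 →
         Disconnected X ⊎ IsPath X → FSDisconnected X (K ks)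
  path ks         X _ _ _      (inj₁ X-disc) = disconnected⇒FSDisconnected X-disc
  path ks@(_ ∷ _) X _ _ last≡2 (inj₂ X-path) = K-path ks (ℕₚ.≤-reflexive (sym last≡2)) X-path
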